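{- $\mathrm{ex}_c(n,S_{2,2,2})=2n-2$ for all $n\ge 7$, and $\mathrm{ex}_c(n,S_{2,2,2})=\binom{n}{2}$ for $1\le n\le 6$.
   Context: $\mathrm{ex}_c(n,F)$ denotes the largest number of edges in a connected $n$-vertex graph containing no subgraph isomorphic to $F$. $S_{2,2,2}$ is the spider consisting of a center vertex with three legs, each a path of 2 edges (7 vertices in total). -}

module Defs where

open import Data.Nat using (ℕ; zero; suc; _≤_)
open import Data.Bool using (Bool; true; false; _∨_; T)
open import Data.Bool.Properties using (∨-comm; T?)
open import Data.Fin using (Fin; toℕ; _<_)
open import Data.Fin.Properties using (_<?_)
open import Data.List using (List; length; filter; allFin; cartesianProduct)
open import Data.Product using (Σ; _×_; _,_; proj₁; proj₂)
open import Relation.Nullary.Decidable using (_×-dec_)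
open import Relation.Nullary using (¬_)
open import Relation.Binary.PropositionalEquality using (_≡_; refl)
open import Function.Definitions using (Injective)

record SimpleGraph (n : ℕ) : Set where
  field
    adj    : Fin n → Fin n → Bool
    sym    : ∀ i j → adj i j ≡ adj j i
    irrefl : ∀ i → adj i i ≡ false
open SimpleGraph public

edgeCount : ∀ {n} → SimpleGraph n → ℕ
edgeCount {n} G =
  length (filter (λ p → (proj₁ p <? proj₂ p) ×-dec T? (adj G (proj₁ p) (proj₂ p)))
                 (cartesianProduct (allFin n) (allFin n)))

data Walk {n : ℕ} (G : SimpleGraph n) : Fin n → Fin n → Set where
  [] : ∀ {u} → Walk G u u
  _∷_ : ∀ {u v w} → T (adj G u v) → Walk G v w → Walk G u w

Connected : ∀ {n} → SimpleGraph n → Set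
Connected {n} G = ∀ (u v : Fin n) → Walk G u v

ContainsSubgraph : ∀ {n k} → SimpleGraph n → SimpleGraph k → Set
ContainsSubgraph {n} {k} G F =
  Σ (Fin k → Fin n) λ f → Injective _≡_ _≡_ f ×
    (∀ i j → T (adj F i j) → T (adj G (f i) (f j)))

IsExc : (n : ℕ) → ∀ {k} → SimpleGraph k → ℕ → Set
IsExc n F m =
  (Σ (SimpleGraph n) λ G → Connected G × ¬ ContainsSubgraph G F × edgeCount G ≡ m)
  × (∀ (G : SimpleGraph n) → Connected G → ¬ ContainsSubgraph G F → edgeCount G ≤ m)

spiderEdge : ℕ → ℕ → Bool
spiderEdge 0 1 = true
spiderEdge 1 2 = true
spiderEdge 0 3 = true
spiderEdge 3 4 = true
spiderEdge 0 5 = true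
spiderEdge 5 6 = true
spiderEdge _ _ = false

spiderAdj : Fin 7 → Fin 7 → Bool
spiderAdj i j = spiderEdge (toℕ i) (toℕ j) ∨ spiderEdge (toℕ j) (toℕ i)

spiderIrrefl : ∀ i → spiderAdj i i ≡ false
spiderIrrefl Fin.zero = refl
spiderIrrefl (Fin.suc Fin.zero) = refl
spiderIrrefl (Fin.suc (Fin.suc Fin.zero)) = refl
spiderIrrefl (Fin.suc (Fin.suc (Fin.suc Fin.zero))) = refl
spiderIrrefl (Fin.suc (Fin.suc (Fin.suc (Fin.suc Fin.zero)))) = refl
spiderIrrefl (Fin.suc (Fin.suc (Fin.suc (Fin.suc (Fin.suc Fin.zero))))) = refl
spiderIrrefl (Fin.suc (Fin.suc (Fin.suc (Fin.suc (Fin.suc (Fin.suc Fin.zero)))))) = refl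

S222 : SimpleGraph 7
S222 = record
  { adj = spiderAdj
  ; sym = λ i j → ∨-comm (spiderEdge (toℕ i) (toℕ j)) (spiderEdge (toℕ j) (toℕ i))
  ; irrefl = spiderIrrefl
  }

{-# OPTIONS --safe #-}

-- Upper bound, by induction on connected vertex sets S of a spider-free graph. Take a longest path
-- p 0, …, p k in S. All neighbours of p 0 lie on it, so p 0 is not a cut vertex; if it has degree
-- at most 2, delete it (for |S| = 7 a finite search on the six other vertices finds a spider).
-- Otherwise, a chord from p 0 to p i with 4 ≤ i ≤ k - 2 gives a spider centred at p i. If p 0 and
-- p k are adjacent, S is a Hamiltonian cycle on which every chord has length 2, and missing chords
-- leave at most 2|S| - 2 edges. If not, k ≥ 6 and p 0 is adjacent exactly to p 1, p 2 and p 3;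
-- then each end of the path is a K₄ hanging at one vertex. Delete the three free vertices
-- (6 edges) of one K₄, or, when fewer than 7 vertices would remain, those of both.
--
-- The bound is attained by joining two adjacent vertices to everything and adding one more edge.

module Submission where

open import Defs
open import Data.Nat using (ℕ; _≤_; _*_; _∸_)
open import Data.Nat.Combinatorics using (_C_)
open import Data.Product using (_×_)

open import Data.Bool using (Bool; true; false; T; not; _∧_; _∨_; if_then_else_)
open import Data.Bool.Properties using (T?; T-∧; T-∨; ∧-comm; ∨-comm)
open import Data.Empty using (⊥; ⊥-elim)
open import Data.Fin using (Fin; zero; suc; toℕ; #_)
open import Data.Fin.Properties using (injective⇒≤; toℕ-injective) renaming (_≟_ to _≟ᶠ_)
import Data.Fin as Fin
import Data.List as List
import Data.Fin.Properties as Fin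
open import Data.List using (List; []; _∷_; _++_; length; filter; map; allFin; tabulate;
  cartesianProduct; applyUpTo)
open import Data.List.Properties using (length-map; length-++; length-tabulate;
  length-applyUpTo; filter-++; filter-accept; filter-reject; ++-identityʳ)
open import Data.List.Membership.Propositional using (_∈_; find; lose)
open import Data.List.Membership.Propositional.Properties
  using (∈-∃++; ∈-allFin; ∈-applyUpTo⁺; ∈-applyUpTo⁻; ∈-map⁺; ∈-lookup)
open import Data.List.Relation.Binary.Permutation.Propositional using (_↭_; ↭-sym; ↭-trans)
import Data.List.Relation.Binary.Permutation.Propositional as ↭
open import Data.List.Relation.Binary.Permutation.Propositional.Properties
  using (shift; ↭-length; ∈-resp-↭; All-resp-↭)
open import Data.List.Relation.Unary.All as All using (All; []; _∷_)
open import Data.List.Relation.Unary.AllPairs using (AllPairs; []; _∷_)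
import Data.List.Relation.Unary.All.Properties as All
import Data.List.Relation.Unary.AllPairs.Properties as AllPairs
open import Data.List.Relation.Unary.Any as Any using (Any; here; there)
open import Data.List.Relation.Unary.Unique.Propositional using (Unique)
import Data.List.Relation.Unary.Unique.Propositional.Properties as Unique
open import Data.Nat using (zero; suc; _+_; _<_; _<ᵇ_; ⌈_/2⌉; _≤?_; _<?_; z≤n; s≤s; s≤s⁻¹)
open import Data.Nat.Properties
open import Data.Nat.Tactic.RingSolver using (solve-∀)
open import Data.Product using (Σ; ∃; ∃₂; _,_; proj₁; proj₂)
open import Data.Sum using (_⊎_; inj₁; inj₂; [_,_]′)
open import Data.Unit using (⊤; tt)
open import Data.Vec using (Vec; []; _∷_; lookup)
import Data.List.Membership.DecPropositional as Membership
import Data.Product.Properties as Product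
open import Function using (_∘_; id; Equivalence; mk⇔)
open import Function.Definitions using (Injective)
open import Relation.Binary.PropositionalEquality
  using (_≡_; _≢_; refl; cong; cong₂; subst; subst₂; module ≡-Reasoning)
import Relation.Binary.PropositionalEquality as ≡
open import Relation.Nullary using (¬_; Dec; yes; no)
open import Relation.Nullary.Decidable 
  using (True; does; does-⇔; dec-true; toWitness; from-yes; _×-dec_; _→-dec_; _⊎-dec_; ¬?)

-- The bound fails below seven vertices: K₆ is spider-free and has 15 edges against 10. Deletion
-- therefore cannot descend freely. At |S| = 7 the six vertices left over come with no inductive
-- bound, which is why a finite search replaces it; for the same reason both K₄ ends must be treated
-- together when removing one would leave too little. Otherwise the budget is exact: a vertex may
-- take two edges with it, the three free vertices of a K₄ end take six.
--
-- Short paths and chords to the penultimate vertex are excluded by one device. A chord from p 0 to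
-- p i yields the path p (i - 1), ..., p 0, p i, ..., p k on the same vertices, so it is again
-- longest, and only its first end has changed. Crossing chords from the two ends thus produce a
-- longest path with adjacent ends. Such a path closes to a cycle; no edge can leave the cycle
-- without giving a longer path, so by connectivity it is all of S, which brings back the
-- Hamiltonian case.

private
  variable
    A : Set

-- Degrees and edge counts along vertex lists

[_]ᵇ : Bool → ℕ
[ b ]ᵇ = if b then 1 else 0

degree : (A → A → Bool) → A → List A → ℕ
degree r v []       = 0
degree r v (u ∷ us) = [ r v u ]ᵇ + degree r v us

edges : (A → A → Bool) → List A → ℕ
edges r []       = 0
edges r (v ∷ vs) = degree r v vs + edges r vs

-- The binomial coefficient n over 2, in the recursion that `edges` follows on a complete graph.
triangular : ℕ → ℕ
triangular zero    = 0
triangular (suc n) = n + triangular n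

module _ {r : A → A → Bool} where

  [-]ᵇ≤1 : ∀ b → [ b ]ᵇ ≤ 1
  [-]ᵇ≤1 true  = ≤-refl
  [-]ᵇ≤1 false = z≤n

  degree≤length : ∀ v us → degree r v us ≤ length us
  degree≤length v []       = z≤n
  degree≤length v (u ∷ us) = +-mono-≤ ([-]ᵇ≤1 (r v u)) (degree≤length v us)

  edges≤triangular : ∀ vs → edges r vs ≤ triangular (length vs)
  edges≤triangular []       = z≤n
  edges≤triangular (v ∷ vs) = +-mono-≤ (degree≤length v vs) (edges≤triangular vs)

  degree-all : ∀ {v us} → All (λ u → T (r v u)) us → degree r v us ≡ length us
  degree-all []                              = refl
  degree-all {v} {u ∷ us} (px ∷ pxs) with true ← r v u = cong suc (degree-all pxs)

  degree-none : ∀ {v us} → All (λ u → ¬ T (r v u)) us → degree r v us ≡ 0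
  degree-none []                             = refl
  degree-none {v} {u ∷ us} (px ∷ pxs) with r v u
  ... | true  = ⊥-elim (px tt)
  ... | false = degree-none pxs

  edges-none : ∀ {vs} → AllPairs (λ v u → ¬ T (r v u)) vs → edges r vs ≡ 0
  edges-none []         = refl
  edges-none (px ∷ pxs) = cong₂ _+_ (degree-none px) (edges-none pxs)

  edges-all : ∀ {vs} → AllPairs (λ v u → T (r v u)) vs → edges r vs ≡ triangular (length vs)
  edges-all []         = refl
  edges-all (px ∷ pxs) = cong₂ _+_ (degree-all px) (edges-all pxs)

  degree-↭ : ∀ {v us ws} → us ↭ ws → degree r v us ≡ degree r v ws
  degree-↭ ↭.refl = refl
  degree-↭ {v} (↭.prep x p) = cong ([ r v x ]ᵇ +_) (degree-↭ p)
  degree-↭ {v} (↭.swap {xs = us} {ys = ws} x y p) = begin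
    a + (b + degree r v us) ≡⟨ cong (λ d → a + (b + d)) (degree-↭ p) ⟩
    a + (b + degree r v ws) ≡⟨ exchange a b _ ⟩
    b + (a + degree r v ws) ∎
    where
    open ≡-Reasoning
    a = [ r v x ]ᵇ
    b = [ r v y ]ᵇ
    exchange : ∀ x y z → x + (y + z) ≡ y + (x + z)
    exchange = solve-∀
  degree-↭ (↭.trans p q) = ≡.trans (degree-↭ p) (degree-↭ q)

  edges-↭ : (∀ x y → r x y ≡ r y x) → ∀ {us ws} → us ↭ ws → edges r us ≡ edges r ws
  edges-↭ r-sym ↭.refl = refl
  edges-↭ r-sym (↭.prep x p) = cong₂ _+_ (degree-↭ p) (edges-↭ r-sym p)
  edges-↭ r-sym (↭.swap {xs = us} {ys = ws} x y p) = begin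
    (a + degree r x us) + (degree r y us + edges r us)
      ≡⟨ cong₂ (λ d e → (a + d) + e) (degree-↭ p) (cong₂ _+_ (degree-↭ p) (edges-↭ r-sym p)) ⟩
    (a + degree r x ws) + (degree r y ws + edges r ws)
      ≡⟨ exchange a _ _ _ ⟩
    (a + degree r y ws) + (degree r x ws + edges r ws)
      ≡⟨ cong (λ b → ([ b ]ᵇ + degree r y ws) + (degree r x ws + edges r ws)) (r-sym x y) ⟩
    ([ r y x ]ᵇ + degree r y ws) + (degree r x ws + edges r ws) ∎
    where
    open ≡-Reasoning
    a = [ r x y ]ᵇ
    exchange : ∀ x y z w → (x + y) + (z + w) ≡ (x + z) + (y + w)
    exchange = solve-∀
  edges-↭ r-sym (↭.trans p q) = ≡.trans (edges-↭ r-sym p) (edges-↭ r-sym q)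

-- Duplicate-free lists as vertex sets

Unique-resp-↭ : ∀ {xs ys : List A} → xs ↭ ys → Unique xs → Unique ys
Unique-resp-↭ ↭.refl u = u
Unique-resp-↭ (↭.prep x p) (x∉ ∷ u) = All-resp-↭ p x∉ ∷ Unique-resp-↭ p u
Unique-resp-↭ (↭.swap x y p) ((x≢y ∷ x∉) ∷ y∉ ∷ u) =
  (x≢y ∘ ≡.sym ∷ All-resp-↭ p y∉) ∷ All-resp-↭ p x∉ ∷ Unique-resp-↭ p u
Unique-resp-↭ (↭.trans p q) u = Unique-resp-↭ q (Unique-resp-↭ p u)

∈⇒↭∷ : ∀ {x : A} {xs} → x ∈ xs → ∃ λ ys → xs ↭ x ∷ ys
∈⇒↭∷ {x = x} x∈ with as , bs , refl ← ∈-∃++ x∈ = as ++ bs , shift x as bs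

∈-drop-head : ∀ {x y : A} {xs} → y ∈ x ∷ xs → y ≢ x → y ∈ xs
∈-drop-head (here eq) y≢x = ⊥-elim (y≢x eq)
∈-drop-head (there p) _   = p

-- Brings chosen vertices to the front, where `edges` splits off their degrees and the remainder
-- `zs` is the set after deletion.
unique-⊆⇒↭++ : ∀ {xs ys : List A} → Unique xs → All (_∈ ys) xs → ∃ λ zs → ys ↭ xs ++ zs
unique-⊆⇒↭++ {ys = ys} [] [] = ys , ↭.refl
unique-⊆⇒↭++ {xs = x ∷ xs} (x∉ ∷ u) (x∈ ∷ xs∈) =
  let ys′ , p = ∈⇒↭∷ x∈
      zs , q  = unique-⊆⇒↭++ u
        (All.zipWith (λ (x≢z , z∈) → ∈-drop-head (∈-resp-↭ p z∈) (x≢z ∘ ≡.sym)) (x∉ , xs∈))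
  in zs , ↭-trans p (↭.prep x q)

unique-⊆⇒length≤ : ∀ {xs ys : List A} → Unique xs → All (_∈ ys) xs → length xs ≤ length ys
unique-⊆⇒length≤ {xs = xs} u xs⊆ =
  let zs , p = unique-⊆⇒↭++ u xs⊆
  in subst (length xs ≤_) (≡.sym (≡.trans (↭-length p) (length-++ xs))) (m≤m+n _ _)

unique-⊆-length⇒↭ : ∀ {xs ys : List A} → Unique xs → All (_∈ ys) xs →
  length xs ≡ length ys → ys ↭ xs
unique-⊆-length⇒↭ {xs = xs} {ys} u xs⊆ eq with unique-⊆⇒↭++ u xs⊆
... | []     , p = subst (ys ↭_) (++-identityʳ xs) p
... | z ∷ zs , p = ⊥-elim (m+1+n≢m (length xs) (≡.sym
  (≡.trans eq (≡.trans (↭-length p) (length-++ xs)))))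

module _ {r : A → A → Bool} where

  neighbours : ∀ v us → Unique us → ∃ λ ns →
    length ns ≡ degree r v us × Unique ns × (∀ {x} → x ∈ ns → x ∈ us × T (r v x))
  neighbours v [] u = [] , refl , [] , λ ()
  neighbours v (x ∷ us) (x∉ ∷ u) with r v x in eq | neighbours v us u
  ... | false | ns , l , un , f = ns , l , un , λ p → there (proj₁ (f p)) , proj₂ (f p)
  ... | true  | ns , l , un , f = x ∷ ns , cong suc l ,
    All.tabulate (λ {y} y∈ x≡y → All.lookup x∉ (proj₁ (f y∈)) x≡y) ∷ un ,
    λ { (here refl) → here refl , subst T (≡.sym eq) tt
      ; (there p) → there (proj₁ (f p)) , proj₂ (f p) }

  -- Only `us` has to be duplicate-free: `ns` is a list of candidates, which may repeat entries or
  -- contain vertices outside `us`.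
  degree≤ : ∀ {v us} → Unique us → ∀ ns → (∀ {x} → x ∈ us → T (r v x) → x ∈ ns) →
    degree r v us ≤ length ns
  degree≤ {v} {us} u ns sub =
    let ms , l , um , f = neighbours v us u
    in subst (_≤ length ns) l
         (unique-⊆⇒length≤ um (All.tabulate λ p → sub (proj₁ (f p)) (proj₂ (f p))))

-- Spiders

legs : List (Fin 7 × Fin 7)
legs = (# 0 , # 1) ∷ (# 1 , # 2) ∷ (# 0 , # 3) ∷ (# 3 , # 4) ∷ (# 0 , # 5) ∷ (# 5 , # 6) ∷ []

-- Decided over all 49 pairs; afterwards an embedding is checked on six oriented edges only.
adj-S222⇒legs : ∀ i j → T (adj S222 i j) → (i , j) ∈ legs ⊎ (j , i) ∈ legs
adj-S222⇒legs = from-yes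
  (Fin.all? λ i → Fin.all? λ j → T? (adj S222 i j) →-dec ((i , j) ∈? legs ⊎-dec (j , i) ∈? legs))
  where open Membership (Product.≡-dec _≟ᶠ_ _≟ᶠ_) using (_∈?_)

LookupInjective : ∀ {m} → Vec A m → Set
LookupInjective s = ∀ i j → lookup s i ≡ lookup s j → i ≡ j

lookupInjective? : ∀ {m n} (s : Vec (Fin n) m) → Dec (LookupInjective s)
lookupInjective? s = Fin.all? λ i → Fin.all? λ j → (lookup s i ≟ᶠ lookup s j) →-dec (i ≟ᶠ j)

-- Order certifies that positions on a path are distinct even when some of them contain a variable
-- and equality cannot be decided by computation.
data Increasing (k : ℕ) : ∀ {m} → Vec ℕ (suc m) → Set where
  [_]  : ∀ {i} → i ≤ k → Increasing k (i ∷ [])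
  _∷_  : ∀ {m i j} {is : Vec ℕ m} → i < j → Increasing k (j ∷ is) → Increasing k (i ∷ j ∷ is)

infixr 5 _∷_

module _ {k : ℕ} where

  increasing-head< : ∀ {m i} {is : Vec ℕ m} → Increasing k (i ∷ is) → ∀ x → i < lookup is x
  increasing-head< (i<j ∷ inc) zero    = i<j
  increasing-head< (i<j ∷ inc) (suc x) = <-trans i<j (increasing-head< inc x)

  increasing-≤ : ∀ {m} {is : Vec ℕ (suc m)} → Increasing k is → ∀ x → lookup is x ≤ k
  increasing-≤ [ i≤k ]     zero    = i≤k
  increasing-≤ (i<j ∷ inc) zero    = ≤-trans (<⇒≤ i<j) (increasing-≤ inc zero)
  increasing-≤ (i<j ∷ inc) (suc x) = increasing-≤ inc x

  increasing-injective : ∀ {m} {is : Vec ℕ (suc m)} → Increasing k is → LookupInjective is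
  increasing-injective inc           zero    zero    eq = refl
  increasing-injective inc@(_ ∷ _)   zero    (suc y) eq = ⊥-elim (<⇒≢ (increasing-head< inc y) eq)
  increasing-injective inc@(_ ∷ _)   (suc x) zero    eq =
    ⊥-elim (<⇒≢ (increasing-head< inc x) (≡.sym eq))
  increasing-injective (i<j ∷ inc) (suc x) (suc y) eq = cong suc (increasing-injective inc x y eq)

-- Exhaustive search for a spider in a graph on Fin 7

vertexPairs : List A → List (A × A)
vertexPairs []       = []
vertexPairs (v ∷ vs) = map (v ,_) vs ++ vertexPairs vs

count : (A → A → Bool) → List (A × A) → ℕ
count r []             = 0
count r ((u , v) ∷ ps) = [ r u v ]ᵇ + count r ps

module _ {r : A → A → Bool} where

  count-++ : ∀ ps qs → count r (ps ++ qs) ≡ count r ps + count r qs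
  count-++ []       qs = refl
  count-++ (p ∷ ps) qs = ≡.trans (cong ([ r (proj₁ p) (proj₂ p) ]ᵇ +_) (count-++ ps qs))
                                 (≡.sym (+-assoc [ r (proj₁ p) (proj₂ p) ]ᵇ _ _))

  degree≡count : ∀ v us → degree r v us ≡ count r (map (v ,_) us)
  degree≡count v []       = refl
  degree≡count v (u ∷ us) = cong ([ r v u ]ᵇ +_) (degree≡count v us)

  edges≡count : ∀ vs → edges r vs ≡ count r (vertexPairs vs)
  edges≡count []       = refl
  edges≡count (v ∷ vs) = ≡.trans (cong₂ _+_ (degree≡count v vs) (edges≡count vs))
                                 (≡.sym (count-++ (map (v ,_) vs) _))

  count≤length : ∀ ps → count r ps ≤ length ps
  count≤length []       = z≤n
  count≤length (p ∷ ps) = +-mono-≤ ([-]ᵇ≤1 {r = r} (r (proj₁ p) (proj₂ p))) (count≤length ps)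

Joins : A × A → A → A → Set
Joins (a , b) x y = (x ≡ a × y ≡ b) ⊎ (x ≡ b × y ≡ a)

joins? : ∀ (e : Fin 7 × Fin 7) x y → Dec (Joins e x y)
joins? (a , b) x y = (x ≟ᶠ a ×-dec y ≟ᶠ b) ⊎-dec (x ≟ᶠ b ×-dec y ≟ᶠ a)

-- A spider is listed centre first, then leg by leg as in S222. The list is a greedy choice of
-- enough spiders for the two searches below to succeed.
spiders : List (Vec (Fin 7) 7)
spiders =
    (# 2 ∷ # 1 ∷ # 0 ∷ # 4 ∷ # 5 ∷ # 6 ∷ # 3 ∷ [])
  ∷ (# 1 ∷ # 0 ∷ # 2 ∷ # 4 ∷ # 3 ∷ # 6 ∷ # 5 ∷ [])
  ∷ (# 3 ∷ # 1 ∷ # 0 ∷ # 2 ∷ # 5 ∷ # 6 ∷ # 4 ∷ [])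
  ∷ (# 5 ∷ # 1 ∷ # 0 ∷ # 2 ∷ # 6 ∷ # 3 ∷ # 4 ∷ [])
  ∷ (# 2 ∷ # 0 ∷ # 1 ∷ # 3 ∷ # 5 ∷ # 4 ∷ # 6 ∷ [])
  ∷ (# 1 ∷ # 0 ∷ # 2 ∷ # 3 ∷ # 6 ∷ # 5 ∷ # 4 ∷ [])
  ∷ (# 6 ∷ # 1 ∷ # 0 ∷ # 2 ∷ # 3 ∷ # 5 ∷ # 4 ∷ [])
  ∷ (# 2 ∷ # 1 ∷ # 0 ∷ # 4 ∷ # 3 ∷ # 5 ∷ # 6 ∷ [])
  ∷ (# 4 ∷ # 1 ∷ # 0 ∷ # 5 ∷ # 3 ∷ # 6 ∷ # 2 ∷ [])
  ∷ (# 6 ∷ # 1 ∷ # 0 ∷ # 3 ∷ # 5 ∷ # 4 ∷ # 2 ∷ [])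
  ∷ (# 5 ∷ # 1 ∷ # 0 ∷ # 2 ∷ # 3 ∷ # 4 ∷ # 6 ∷ [])
  ∷ (# 3 ∷ # 1 ∷ # 0 ∷ # 2 ∷ # 4 ∷ # 5 ∷ # 6 ∷ [])
  ∷ (# 6 ∷ # 1 ∷ # 4 ∷ # 2 ∷ # 0 ∷ # 3 ∷ # 5 ∷ [])
  ∷ (# 4 ∷ # 1 ∷ # 6 ∷ # 2 ∷ # 0 ∷ # 5 ∷ # 3 ∷ [])
  ∷ (# 6 ∷ # 1 ∷ # 5 ∷ # 2 ∷ # 0 ∷ # 4 ∷ # 3 ∷ [])
  ∷ (# 4 ∷ # 1 ∷ # 3 ∷ # 2 ∷ # 0 ∷ # 6 ∷ # 5 ∷ [])
  ∷ (# 4 ∷ # 1 ∷ # 0 ∷ # 3 ∷ # 6 ∷ # 5 ∷ # 2 ∷ [])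
  ∷ (# 5 ∷ # 1 ∷ # 0 ∷ # 3 ∷ # 2 ∷ # 6 ∷ # 4 ∷ [])
  ∷ (# 6 ∷ # 1 ∷ # 3 ∷ # 2 ∷ # 0 ∷ # 4 ∷ # 5 ∷ [])
  ∷ (# 4 ∷ # 1 ∷ # 0 ∷ # 3 ∷ # 2 ∷ # 6 ∷ # 5 ∷ [])
  ∷ (# 5 ∷ # 1 ∷ # 4 ∷ # 2 ∷ # 0 ∷ # 6 ∷ # 3 ∷ [])
  ∷ (# 4 ∷ # 1 ∷ # 0 ∷ # 2 ∷ # 5 ∷ # 3 ∷ # 6 ∷ [])
  ∷ (# 3 ∷ # 1 ∷ # 6 ∷ # 2 ∷ # 0 ∷ # 4 ∷ # 5 ∷ [])
  ∷ []

spiders-injective : All LookupInjective spiders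
spiders-injective = from-yes (All.all? lookupInjective? spiders)

Leg : Vec (Fin 7) 7 → (Fin 7 → Fin 7 → Set) → Set
Leg s P = All (λ (i , j) → P (lookup s i) (lookup s j)) legs

Avoids : Fin 7 × Fin 7 → Vec (Fin 7) 7 → Set
Avoids e s = Leg s λ x y → ¬ Joins e x y

avoids? : ∀ e s → Dec (Avoids e s)
avoids? e s = All.all? (λ (i , j) → ¬? (joins? e (lookup s i) (lookup s j))) legs

-- Some listed spider survives the deletion of any m of the given pairs.
Robust : List (Fin 7 × Fin 7) → ℕ → List (Vec (Fin 7) 7) → Set
Robust _        _       []         = ⊥
Robust []       _       (_ ∷ _)    = ⊤
Robust (_ ∷ _)  zero    (_ ∷ _)    = ⊤
Robust (p ∷ ps) (suc m) ss@(_ ∷ _) = Robust ps (suc m) ss × Robust ps m (filter (avoids? p) ss)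

robust? : ∀ ps m ss → Dec (Robust ps m ss)
robust? _        _       []         = no id
robust? []       _       (_ ∷ _)    = yes tt
robust? (_ ∷ _)  zero    (_ ∷ _)    = yes tt
robust? (p ∷ ps) (suc m) ss@(_ ∷ _) =
  robust? ps (suc m) ss ×-dec robust? ps m (filter (avoids? p) ss)

-- In both searches `# 0` plays the deleted vertex of low degree, and `block` the six others.
block : List (Fin 7)
block = # 1 ∷ # 2 ∷ # 3 ∷ # 4 ∷ # 5 ∷ # 6 ∷ []

JoinedBy : List (Fin 7 × Fin 7) → Fin 7 → Fin 7 → Set
JoinedBy es x y = Any (λ e → Joins e x y) es

usable? : ∀ known s → Dec (Leg s λ x y → JoinedBy known x y ⊎ JoinedBy (vertexPairs block) x y)
usable? known s = All.all? (λ (i , j) →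
  Any.any? (λ e → joins? e (lookup s i) (lookup s j)) known ⊎-dec
  Any.any? (λ e → joins? e (lookup s i) (lookup s j)) (vertexPairs block)) legs

module _ {r : Fin 7 → Fin 7 → Bool} (r-sym : ∀ i j → r i j ≡ r j i) where

  Spider : Set
  Spider = Σ (Vec (Fin 7) 7) λ s → LookupInjective s × Leg s λ x y → T (r x y)

  joins⇒r : ∀ {e x y} → T (r (proj₁ e) (proj₂ e)) → Joins e x y → T (r x y)
  joins⇒r t (inj₁ (refl , refl)) = t
  joins⇒r t (inj₂ (refl , refl)) = subst T (r-sym _ _) t

  Pending : List (Fin 7 × Fin 7) → Vec (Fin 7) 7 → Set
  Pending ps s = Leg s λ x y → T (r x y) ⊎ JoinedBy ps x y

  -- The numerical hypothesis says that at most `m` of the undecided pairs are non-edges. Each pair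
  -- is decided in turn: an edge confirms the legs that use it, a non-edge costs one unit of `m` and
  -- removes the spiders that use it. A non-edge at `m` = 0 contradicts the count, and any spider
  -- left at the end has all its legs confirmed.
  robust⇒spider : ∀ ps m ss → Robust ps m ss → length ps ≤ count r ps + m →
    All LookupInjective ss → All (Pending ps) ss → Spider
  robust⇒spider [] m (s ∷ _) rob le (inj ∷ _) (pend ∷ _) =
    s , inj , All.map [ id , (λ ()) ]′ pend
  robust⇒spider ((a , b) ∷ ps) m ss@(_ ∷ _) rob le injs pends with r a b in eq
  ... | true  = robust⇒spider ps m ss (keep m rob) (s≤s⁻¹ le) injs (All.map (All.map drop) pends)
    where
    robust-zero : ∀ ps {s ss} → Robust ps zero (s ∷ ss)
    robust-zero []      = tt
    robust-zero (_ ∷ _) = tt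
    keep : ∀ m → Robust ((a , b) ∷ ps) m ss → Robust ps m ss
    keep zero    _       = robust-zero ps
    keep (suc m) (k , _) = k
    drop : ∀ {x y} → T (r x y) ⊎ JoinedBy ((a , b) ∷ ps) x y → T (r x y) ⊎ JoinedBy ps x y
    drop (inj₁ t)         = inj₁ t
    drop (inj₂ (here h))  = inj₁ (joins⇒r (subst T (≡.sym eq) tt) h)
    drop (inj₂ (there x)) = inj₂ x
  robust⇒spider (_ ∷ ps) zero (_ ∷ _) rob le injs pends | false =
    ⊥-elim (<⇒≱ (s≤s (count≤length ps)) (subst (suc (length ps) ≤_) (+-identityʳ _) le))
  robust⇒spider ((a , b) ∷ ps) (suc m) ss@(_ ∷ _) (_ , delete) le injs pends | false =
    robust⇒spider ps m (filter (avoids? (a , b)) ss) delete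
      (s≤s⁻¹ (subst (suc (length ps) ≤_) (+-suc _ m) le))
      (All.filter⁺ (avoids? (a , b)) injs)
      (All.zipWith (λ {s} → drop-leg s)
        (All.all-filter (avoids? (a , b)) ss , All.filter⁺ (avoids? (a , b)) pends))
    where
    drop : ∀ {x y} → ¬ Joins (a , b) x y × (T (r x y) ⊎ JoinedBy ((a , b) ∷ ps) x y) →
      T (r x y) ⊎ JoinedBy ps x y
    drop (_  , inj₁ t)         = inj₁ t
    drop (¬h , inj₂ (here h))  = ⊥-elim (¬h h)
    drop (_  , inj₂ (there x)) = inj₂ x
    drop-leg : ∀ s → Avoids (a , b) s × Pending ((a , b) ∷ ps) s → Pending ps s
    drop-leg s (av , pend) = All.zipWith drop (av , pend)

  -- Six vertices form 15 pairs, so at most `m` pairs of the block are missing.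
  block-spider : ∀ known m → Robust (vertexPairs block) m (filter (usable? known) spiders) →
    All (λ e → T (r (proj₁ e) (proj₂ e))) known → 15 ≤ edges r block + m → Spider
  block-spider known m rob present le = robust⇒spider (vertexPairs block) m _ rob
    (subst (λ e → 15 ≤ e + m) (edges≡count {r = r} block) le)
    (All.filter⁺ (usable? known) spiders-injective)
    (All.map (λ {s} → resolve-leg s) (All.all-filter (usable? known) spiders))
    where
    resolve : ∀ {x y} → JoinedBy known x y ⊎ JoinedBy (vertexPairs block) x y →
      T (r x y) ⊎ JoinedBy (vertexPairs block) x y
    resolve (inj₁ j) with _ , e∈ , h ← find j = inj₁ (joins⇒r (All.lookup present e∈) h)
    resolve (inj₂ j) = inj₂ j
    resolve-leg : ∀ s → Leg s (λ x y → JoinedBy known x y ⊎ JoinedBy (vertexPairs block) x y) →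
      Pending (vertexPairs block) s
    resolve-leg s = All.map resolve

  -- The threshold is sharp: K₅ with two pendant edges at one vertex has no spider.
  pendant-spider : T (r (# 0) (# 1)) → 12 ≤ edges r block → Spider
  pendant-spider r₀₁ e≥12 = block-spider known 3
    (from-yes (robust? (vertexPairs block) 3 (filter (usable? known) spiders)))
    (r₀₁ ∷ []) (+-monoˡ-≤ 3 e≥12)
    where
    known : List (Fin 7 × Fin 7)
    known = (# 0 , # 1) ∷ []

  -- A spider on seven vertices must use `# 0`. With one known edge `# 0` can only be the foot of a
  -- leg through `# 1`; with two it may also hang from `# 2` or lie between `# 1` and `# 2`. The
  -- larger choice of spiders compensates for one more missing pair.
  cap-spider : T (r (# 0) (# 1)) → T (r (# 0) (# 2)) → 11 ≤ edges r block → Spider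
  cap-spider r₀₁ r₀₂ e≥11 = block-spider known 4
    (from-yes (robust? (vertexPairs block) 4 (filter (usable? known) spiders)))
    (r₀₁ ∷ r₀₂ ∷ []) (+-monoˡ-≤ 4 e≥11)
    where
    known : List (Fin 7 × Fin 7)
    known = (# 0 , # 1) ∷ (# 0 , # 2) ∷ []

-- Longest paths in spider-free graphs

module SpiderFree {n : ℕ} (G : SimpleGraph n) (free : ¬ ContainsSubgraph G S222) where

  V : Set
  V = Fin n

  infix 4 _~_

  _~_ : V → V → Set
  u ~ v = T (adj G u v)

  ~-sym : ∀ {u v} → u ~ v → v ~ u
  ~-sym {u} {v} = subst T (sym G u v)

  ~-irrefl : ∀ {u} → ¬ (u ~ u)
  ~-irrefl {u} = subst T (irrefl G u)

  ~⇒≢ : ∀ {u v} → u ~ v → u ≢ v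
  ~⇒≢ u~u refl = ~-irrefl u~u

  no-spider : (f : Fin 7 → V) → Injective _≡_ _≡_ f → ¬ All (λ (i , j) → f i ~ f j) legs
  no-spider f inj f-legs = free (f , inj , λ i j t →
    [ All.lookup f-legs , ~-sym ∘ All.lookup f-legs ]′ (adj-S222⇒legs i j t))

  private
    variable
      S S′ : List V
      k : ℕ
      p : ℕ → V
      u v w : V

  -- Connected vertex sets

  data Reach (S : List V) : V → V → Set where
    done : Reach S u u
    step : u ~ v → v ∈ S → Reach S v w → Reach S u w

  -- Connectivity of a set is expressed inside the fixed graph `G`, so the induction never has to
  -- form an induced subgraph.
  ConnectedOn : List V → Set
  ConnectedOn S = ∀ {u v} → u ∈ S → v ∈ S → Reach S u v

  reach-trans : Reach S u v → Reach S v w → Reach S u w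
  reach-trans done           r′ = r′
  reach-trans (step e v∈ r) r′ = step e v∈ (reach-trans r r′)

  reach-sym : u ∈ S → Reach S u v → Reach S v u
  reach-sym u∈ done          = done
  reach-sym u∈ (step e v∈ r) = reach-trans (reach-sym v∈ r) (step (~-sym e) u∈ done)

  -- A walk to `w` is followed until it is about to enter `v`. The vertex reached by then is a
  -- neighbour of `v`, and its detour replaces the rest of the walk.
  connected-remove : ConnectedOn S → S ↭ v ∷ S′ → w ∈ S′ →
    (∀ {u} → u ∈ S′ → v ~ u → Reach S′ u w) → ConnectedOn S′
  connected-remove {S} {v} {S′} {w} conn S↭ w∈ detour {x} {y} x∈ y∈ =
    reach-trans (to-w x∈) (reach-sym y∈ (to-w y∈))
    where
    ∈S : ∀ {x} → x ∈ S′ → x ∈ S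
    ∈S x∈ = ∈-resp-↭ (↭-sym S↭) (there x∈)
    go : ∀ {x} → x ∈ S′ → Reach S x w → Reach S′ x w
    go x∈ done = done
    go x∈ (step {v = y} e y∈ r) with y ≟ᶠ v
    ... | yes refl = detour x∈ (~-sym e)
    ... | no  y≢v  = step e y∈′ (go y∈′ r)
      where
      y∈′ : y ∈ S′
      y∈′ = ∈-drop-head (∈-resp-↭ S↭ y∈) y≢v
    to-w : ∀ {x} → x ∈ S′ → Reach S′ x w
    to-w x∈ = go x∈ (conn (∈S x∈) (∈S w∈))

  -- Paths and their reindexings

  record Path (S : List V) (k : ℕ) (p : ℕ → V) : Set where
    field
      inside    : ∀ {i} → i ≤ k → p i ∈ S
      injective : ∀ {i j} → i ≤ k → j ≤ k → p i ≡ p j → i ≡ j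
      edge      : ∀ {i} → i < k → p i ~ p (suc i)

  open Path

  -- A path is a total function whose values beyond `k` are irrelevant, so reversal, partial
  -- reversal and cyclic shift are all compositions with a map of indices.
  path-reindex : Path S k p → (σ : ℕ → ℕ) → (∀ {i} → i ≤ k → σ i ≤ k) →
    (∀ {i j} → i ≤ k → j ≤ k → σ i ≡ σ j → i ≡ j) →
    (∀ {i} → i < k → p (σ i) ~ p (σ (suc i))) → Path S k (p ∘ σ)
  path-reindex P σ σ≤k σ-inj σ-edge = record
    { inside    = λ i≤k → inside P (σ≤k i≤k)
    ; injective = λ i≤k j≤k eq → σ-inj i≤k j≤k (injective P (σ≤k i≤k) (σ≤k j≤k) eq)
    ; edge      = σ-edge }

  reverse : ℕ → (ℕ → V) → (ℕ → V)
  reverse k p i = p (k ∸ i)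

  reverse-path : Path S k p → Path S k (reverse k p)
  reverse-path {k = k} {p = p} P = path-reindex P (k ∸_) (λ {i} _ → m∸n≤m k i) ∸-cancelˡ-≡ back
    where
    back : ∀ {i} → i < k → p (k ∸ i) ~ p (k ∸ suc i)
    back {i} i<k = subst (λ l → p l ~ p (k ∸ suc i)) (suc[m∸1+n] i<k)
                     (~-sym (edge P (subst (_≤ k) (≡.sym (suc[m∸1+n] i<k)) (m∸n≤m k i))))
      where
      suc[m∸1+n] : ∀ {m n} → n < m → suc (m ∸ suc n) ≡ m ∸ n
      suc[m∸1+n] {m} {n} n<m = ≡.sym (+-∸-assoc 1 n<m)

  -- With `reverse₃` below, the Pósa rotations for chords from `p 0` to `p 2` and `p 3`: an initial
  -- segment is reversed and the chord joins it to the rest, so that `p 1` or `p 2` becomes the end.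
  reverse₂ : ℕ → ℕ
  reverse₂ 0 = 1
  reverse₂ 1 = 0
  reverse₂ i = i

  reverse₂-path : 2 ≤ k → Path S k p → p 0 ~ p 2 → Path S k (p ∘ reverse₂)
  reverse₂-path {k} {p = p} 2≤k P p₀~p₂ = path-reindex P reverse₂ bounded
    (λ {i} {j} _ _ eq → ≡.trans (≡.sym (involutive i))
      (≡.trans (cong reverse₂ eq) (involutive j))) edge′
    where
    bounded : ∀ {i} → i ≤ k → reverse₂ i ≤ k
    bounded {0}           _   = <⇒≤ 2≤k
    bounded {1}           _   = z≤n
    bounded {suc (suc i)} i≤k = i≤k
    involutive : ∀ i → reverse₂ (reverse₂ i) ≡ i
    involutive 0             = refl
    involutive 1             = refl
    involutive (suc (suc i)) = refl
    edge′ : ∀ {i} → i < k → p (reverse₂ i) ~ p (reverse₂ (suc i))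
    edge′ {0}           _   = ~-sym (edge P (<⇒≤ 2≤k))
    edge′ {1}           _   = p₀~p₂
    edge′ {suc (suc i)} i<k = edge P i<k

  reverse₃ : ℕ → ℕ
  reverse₃ 0 = 2
  reverse₃ 1 = 1
  reverse₃ 2 = 0
  reverse₃ i = i

  reverse₃-path : 3 ≤ k → Path S k p → p 0 ~ p 3 → Path S k (p ∘ reverse₃)
  reverse₃-path {k} {p = p} 3≤k P p₀~p₃ = path-reindex P reverse₃ bounded
    (λ {i} {j} _ _ eq → ≡.trans (≡.sym (involutive i))
      (≡.trans (cong reverse₃ eq) (involutive j))) edge′
    where
    bounded : ∀ {i} → i ≤ k → reverse₃ i ≤ k
    bounded {0}                 _   = <⇒≤ 3≤k
    bounded {1}                 i≤k = i≤k
    bounded {2}                 _   = z≤n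
    bounded {suc (suc (suc i))} i≤k = i≤k
    involutive : ∀ i → reverse₃ (reverse₃ i) ≡ i
    involutive 0                   = refl
    involutive 1                   = refl
    involutive 2                   = refl
    involutive (suc (suc (suc i))) = refl
    edge′ : ∀ {i} → i < k → p (reverse₃ i) ~ p (reverse₃ (suc i))
    edge′ {0}                 _   = ~-sym (edge P (<⇒≤ 3≤k))
    edge′ {1}                 i<k = ~-sym (edge P (<⇒≤ i<k))
    edge′ {2}                 _   = p₀~p₃
    edge′ {suc (suc (suc i))} i<k = edge P i<k

  -- The successor modulo `suc k`. Shifting a cycle repeatedly reduces claims about `p i` to claims
  -- about `p 0`.
  rotate : ℕ → ℕ → ℕ
  rotate k i with i <? k
  ... | yes _ = suc i
  ... | no  _ = 0

  rotate-< : ∀ {i} → i < k → rotate k i ≡ suc i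
  rotate-< {k} {i} i<k with i <? k
  ... | yes _   = refl
  ... | no  i≮k = ⊥-elim (i≮k i<k)

  rotate-last : rotate k k ≡ 0
  rotate-last {k} with k <? k
  ... | yes k<k = ⊥-elim (<-irrefl refl k<k)
  ... | no  _   = refl

  rotate-path : Path S k p → p k ~ p 0 → Path S k (p ∘ rotate k)
  rotate-path {S} {k} {p} P closed = path-reindex P (rotate k) bounded rotate-inj edge′
    where
    bounded : ∀ {i} → i ≤ k → rotate k i ≤ k
    bounded {i} i≤k with i <? k
    ... | yes i<k = i<k
    ... | no  _   = z≤n
    rotate-inj : ∀ {i j} → i ≤ k → j ≤ k → rotate k i ≡ rotate k j → i ≡ j
    rotate-inj {i} {j} i≤k j≤k eq with i <? k | j <? k
    ... | yes _   | yes _   = suc-injective eq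
    ... | no  i≮k | no  j≮k = ≡.trans (≤-antisym i≤k (≮⇒≥ i≮k)) (≤-antisym (≮⇒≥ j≮k) j≤k)
    ... | yes _   | no  _   = ⊥-elim (1+n≢0 eq)
    ... | no  _   | yes _   = ⊥-elim (1+n≢0 (≡.sym eq))
    edge′ : ∀ {i} → i < k → p (rotate k i) ~ p (rotate k (suc i))
    edge′ {i} i<k with suc i <? k
    ... | yes 1+i<k = subst (λ l → p l ~ p (suc (suc i))) (≡.sym (rotate-< i<k)) (edge P 1+i<k)
    ... | no  1+i≮k = subst (λ l → p l ~ p 0)
      (≡.trans (≤-antisym (≮⇒≥ 1+i≮k) i<k) (≡.sym (rotate-< i<k))) closed

  extend : V → (ℕ → V) → (ℕ → V)
  extend v p zero    = v
  extend v p (suc i) = p i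

  extend-path : Path S k p → v ∈ S → (∀ {i} → i ≤ k → v ≢ p i) → v ~ p 0 →
    Path S (suc k) (extend v p)
  extend-path {S} {k} {p} {v} P v∈ v∉ v~p₀ = record
    { inside    = λ { {zero} _ → v∈ ; {suc i} (s≤s i≤k) → inside P i≤k }
    ; injective = inj
    ; edge      = λ { {zero} _ → v~p₀ ; {suc i} (s≤s i<k) → edge P i<k } }
    where
    inj : ∀ {i j} → i ≤ suc k → j ≤ suc k → extend v p i ≡ extend v p j → i ≡ j
    inj {zero}  {zero}  _         _         _  = refl
    inj {zero}  {suc j} _         (s≤s j≤k) eq = ⊥-elim (v∉ j≤k eq)
    inj {suc i} {zero}  (s≤s i≤k) _         eq = ⊥-elim (v∉ i≤k (≡.sym eq))
    inj {suc i} {suc j} (s≤s i≤k) (s≤s j≤k) eq = cong suc (injective P i≤k j≤k eq)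

  path-reach : Path S k p → ∀ d i → i + d ≡ k → (∀ {l} → i ≤ l → l ≤ k → p l ∈ S′) →
    Reach S′ (p i) (p k)
  path-reach {k = k} {p = p} P zero i eq ∈S′ =
    subst (λ l → Reach _ (p i) (p l)) (≡.trans (≡.sym (+-identityʳ i)) eq) done
  path-reach {k = k} P (suc d) i eq ∈S′ =
    step (edge P i<k) (∈S′ (n≤1+n i) i<k) (path-reach P d (suc i) eq′ (λ le → ∈S′ (<⇒≤ le)))
    where
    eq′ : suc i + d ≡ k
    eq′ = ≡.trans (≡.sym (+-suc i d)) eq
    i<k : i < k
    i<k = subst (suc i ≤_) eq′ (m≤m+n (suc i) d)

  -- The positions are listed in path order and `s` arranges them as a spider. Since `s` is a
  -- concrete vector at every use, its injectivity is decided by computation.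
  no-path-spider : Path S k p → {is : Vec ℕ 7} → Increasing k is → (s : Vec (Fin 7) 7) →
    {True (lookupInjective? s)} →
    ¬ Leg s (λ x y → p (lookup is x) ~ p (lookup is y))
  no-path-spider {p = p} P {is} inc s {ok} = no-spider (λ i → p (lookup is (lookup s i)))
    (λ {i} {j} eq → toWitness ok i j (increasing-injective inc _ _
      (injective P (increasing-≤ inc _) (increasing-≤ inc _) eq)))

  path-unique : Path S k p → Unique (applyUpTo p (suc k))
  path-unique {k = k} {p = p} P = Unique.applyUpTo⁺₁ p (suc k)
    λ i<j j<k eq → <⇒≢ i<j (injective P (<⇒≤ (≤-trans i<j (s≤s⁻¹ j<k))) (s≤s⁻¹ j<k) eq)

  path-⊆ : Path S k p → All (_∈ S) (applyUpTo p (suc k))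
  path-⊆ {k = k} {p = p} P = All.applyUpTo⁺₁ p (suc k) λ i<k → inside P (s≤s⁻¹ i<k)

  path-length : Path S k p → suc k ≤ length S
  path-length {S} {k} {p} P = subst (_≤ length S) (length-applyUpTo p (suc k))
    (unique-⊆⇒length≤ (path-unique P) (path-⊆ P))

  e : List V → ℕ
  e = edges (adj G)

  -- The bound of the theorem, without truncated subtraction.
  Sparse : List V → Set
  Sparse S = e S + 2 ≤ 2 * length S

  -- Longest paths, open and closed

  module OnSet {S : List V} (unique : Unique S) (connected : ConnectedOn S) where

    -- Excluding length `suc k` suffices, as any longer path contains one of that length. The field
    -- `maximal` does not mention `p`, so it passes unchanged to every reindexed path.
    record Longest (k : ℕ) (p : ℕ → V) : Set where
      constructor longest
      field
        path    : Path S k p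
        maximal : ∀ {q} → ¬ Path S (suc k) q

    open Longest

    on-path? : ∀ k (p : ℕ → V) (v : V) → Dec (∃ λ i → i < suc k × v ≡ p i)
    on-path? k p v = anyUpTo? (λ i → v ≟ᶠ p i) (suc k)

    neighbour-on-path : Longest k p → v ∈ S → p 0 ~ v → ∃ λ i → 1 ≤ i × i ≤ k × v ≡ p i
    neighbour-on-path {k} {p} {v} L v∈ p₀~v with on-path? k p v
    ... | yes (zero  , _   , refl) = ⊥-elim (~-irrefl p₀~v)
    ... | yes (suc i , i<k , eq)   = suc i , s≤s z≤n , s≤s⁻¹ i<k , eq
    ... | no  off = ⊥-elim (maximal L (extend-path (path L) v∈
      (λ {i} i≤k eq → off (i , s≤s i≤k , eq)) (~-sym p₀~v)))

    reverse-longest : Longest k p → Longest k (reverse k p)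
    reverse-longest L = longest (reverse-path (path L)) (maximal L)

    reverse₂-longest : 2 ≤ k → Longest k p → p 0 ~ p 2 → Longest k (p ∘ reverse₂)
    reverse₂-longest 2≤k L a = longest (reverse₂-path 2≤k (path L) a) (maximal L)

    reverse₃-longest : 3 ≤ k → Longest k p → p 0 ~ p 3 → Longest k (p ∘ reverse₃)
    reverse₃-longest 3≤k L a = longest (reverse₃-path 3≤k (path L) a) (maximal L)

    -- Around the centre `p (4 + j)` one leg takes the chord and then `p 1`, the other two follow
    -- the path in both directions. The offset 4 keeps `p 1` apart from `p (2 + j)`, and `6 + j ≤ k`
    -- leaves room for the forward leg.
    no-middle-chord : Path S k p → ∀ j → 6 + j ≤ k → ¬ (p 0 ~ p (4 + j))
    no-middle-chord P j 6+j≤k a = no-path-spider P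
      {0 ∷ 1 ∷ 2 + j ∷ 3 + j ∷ 4 + j ∷ 5 + j ∷ 6 + j ∷ []}
      (s≤s z≤n ∷ s≤s (s≤s z≤n) ∷ ≤-refl ∷ ≤-refl ∷ ≤-refl ∷ ≤-refl ∷ [ 6+j≤k ])
      (# 4 ∷ # 0 ∷ # 1 ∷ # 3 ∷ # 2 ∷ # 5 ∷ # 6 ∷ [])
      ( ~-sym a
      ∷ edge P (≤-trans (s≤s z≤n) 6+j≤k)
      ∷ ~-sym (edge P (≤-trans (n≤1+n _) (≤-trans (n≤1+n _) 6+j≤k)))
      ∷ ~-sym (edge P (≤-trans (n≤1+n _) (≤-trans (n≤1+n _) (≤-trans (n≤1+n _) 6+j≤k))))
      ∷ edge P (≤-trans (n≤1+n _) 6+j≤k)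
      ∷ edge P 6+j≤k
      ∷ [])

    Closed : ℕ → (ℕ → V) → Set
    Closed k p = Longest k p × p k ~ p 0

    rotate-closed : 0 < k → Closed k p → Closed k (p ∘ rotate k)
    rotate-closed {k} {p} 0<k (L , a) = longest (rotate-path (path L) a) (maximal L) ,
      subst (λ l → p l ~ p (rotate k 0)) (≡.sym rotate-last)
        (subst (λ l → p 0 ~ p l) (≡.sym (rotate-< 0<k)) (edge (path L) 0<k))

    closed-nontrivial : Closed k p → 0 < k
    closed-nontrivial {zero}  (_ , a) = ⊥-elim (~-irrefl a)
    closed-nontrivial {suc k} _       = s≤s z≤n

    -- Rotation brings `p i` to the front, where an outside neighbour would extend the path.
    closed-no-exit : ∀ i → Closed k p → i ≤ k → v ∈ S → (∀ {j} → j ≤ k → v ≢ p j) → ¬ (v ~ p i)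
    closed-no-exit zero (L , _) _ v∈ off v~p = maximal L (extend-path (path L) v∈ off v~p)
    closed-no-exit {k} {p} {v} (suc i) H i<k v∈ off v~p =
      closed-no-exit i (rotate-closed (closed-nontrivial H) H) (<⇒≤ i<k) v∈
        (λ {j} _ → off (rotate-≤ j)) (subst (λ l → v ~ p l) (≡.sym (rotate-< i<k)) v~p)
      where
      rotate-≤ : ∀ j → rotate k j ≤ k
      rotate-≤ j with j <? k
      ... | yes j<k = j<k
      ... | no  _   = z≤n

    closed-spanning : Closed k p → v ∈ S → ∃ λ i → i < suc k × v ≡ p i
    closed-spanning {k} {p} {v} H@(L , _) v∈ with on-path? k p v
    ... | yes on  = on
    ... | no  off = ⊥-elim (walk v∈ off (connected v∈ (inside (path L) z≤n)))
      where
      walk : ∀ {v} → v ∈ S → ¬ (∃ λ i → i < suc k × v ≡ p i) → ¬ Reach S v (p 0)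
      walk v∈ off done = off (0 , s≤s z≤n , refl)
      walk v∈ off (step {v = w} v~w w∈ r) with on-path? k p w
      ... | no  off′ = walk w∈ off′ r
      ... | yes (i , i<k , refl) = closed-no-exit i H (s≤s⁻¹ i<k) v∈
        (λ {j} j≤k eq → off (j , s≤s j≤k , eq)) v~w

    closed-↭ : Closed k p → S ↭ applyUpTo p (suc k)
    closed-↭ {k} {p} H@(L , _) = unique-⊆-length⇒↭ (path-unique (path L)) (path-⊆ (path L))
      (≤-antisym (unique-⊆⇒length≤ (path-unique (path L)) (path-⊆ (path L)))
        (unique-⊆⇒length≤ unique (All.tabulate λ v∈ →
          let i , i<k , eq = closed-spanning H v∈
          in subst (_∈ applyUpTo p (suc k)) (≡.sym eq) (∈-applyUpTo⁺ p i<k))))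

    -- The cycle has k + 1 vertices, so the last bound makes the chord span at least 3 the other way
    -- round as well. After rotation to `p 0`, span 3 needs its own spider: at the centre `p 3` the
    -- backward leg already occupies `p 1`, so the chord's leg continues over the closing edge to
    -- `p k`.
    no-long-chord : 6 ≤ k → ∀ i d → Closed k p → i + (3 + d) ≤ k → 5 + d ≤ k →
      ¬ (p i ~ p (i + (3 + d)))
    no-long-chord 6≤k zero zero (L , c) _ _ a = no-path-spider (path L)
      {0 ∷ 1 ∷ 2 ∷ 3 ∷ 4 ∷ 5 ∷ _ ∷ []}
      (≤-refl ∷ ≤-refl ∷ ≤-refl ∷ ≤-refl ∷ ≤-refl ∷ 6≤k ∷ [ ≤-refl ])
      (# 3 ∷ # 0 ∷ # 6 ∷ # 2 ∷ # 1 ∷ # 4 ∷ # 5 ∷ [])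
      ( ~-sym a
      ∷ ~-sym c
      ∷ ~-sym (edge (path L) (≤-trans (m≤m+n 3 3) 6≤k))
      ∷ ~-sym (edge (path L) (≤-trans (m≤m+n 2 4) 6≤k))
      ∷ edge (path L) (≤-trans (m≤m+n 4 2) 6≤k)
      ∷ edge (path L) (≤-trans (m≤m+n 5 1) 6≤k)
      ∷ [])
    no-long-chord 6≤k zero (suc d) (L , _) _ 6+d≤k = no-middle-chord (path L) d 6+d≤k
    no-long-chord {k} {p} 6≤k (suc i) d H i+d<k 5+d≤k a =
      no-long-chord 6≤k i d (rotate-closed (closed-nontrivial H) H) (<⇒≤ i+d<k) 5+d≤k
        (subst (λ l → p l ~ p (rotate k (i + (3 + d))))
           (≡.sym (rotate-< (≤-trans (s≤s (m≤m+n i (3 + d))) i+d<k)))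
           (subst (λ l → p (suc i) ~ p l) (≡.sym (rotate-< i+d<k)) a))

    -- Every vertex has at most two forward neighbours, except that the last two vertices contribute
    -- a single edge between them.
    band-edges : ∀ m (q : ℕ → V) → Unique (applyUpTo q (2 + m)) →
      (∀ i d → i + (3 + d) ≤ suc m → ¬ (q i ~ q (i + (3 + d)))) →
      e (applyUpTo q (2 + m)) ≤ 1 + 2 * m
    band-edges zero q u band = edges≤triangular {r = adj G} (q 0 ∷ q 1 ∷ [])
    band-edges (suc m) q (_ ∷ u) band = ≤-trans
      (+-mono-≤ (degree≤ {r = adj G} {v = q 0} u (q 1 ∷ q 2 ∷ []) near)
        (band-edges m (q ∘ suc) u λ i d le → band (suc i) d (s≤s le)))
      (≤-reflexive (arith m))
      where
      arith : ∀ m → 2 + (1 + 2 * m) ≡ 1 + 2 * suc m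
      arith = solve-∀
      near : ∀ {x} → x ∈ applyUpTo (q ∘ suc) (2 + m) → q 0 ~ x → x ∈ q 1 ∷ q 2 ∷ []
      near x∈ a with ∈-applyUpTo⁻ (q ∘ suc) x∈
      ... | 0           , _  , refl = here refl
      ... | 1           , _  , refl = there (here refl)
      ... | suc (suc d) , lt , refl = ⊥-elim (band 0 d lt a)

    -- Counting edges on a Hamiltonian cycle

    module Hamiltonian {m : ℕ} {p : ℕ → V} (H : Closed (6 + m) p) where

      private
        P : Path S (6 + m) p
        P = path (proj₁ H)

      -- On 7 + m vertices the last alternative is cyclic distance at most 2 measured through the
      -- closing edge.
      chord : ∀ i {j} → i < j → j ≤ 6 + m → p i ~ p j →
        j ≡ 1 + i ⊎ j ≡ 2 + i ⊎ 5 + m + i ≤ j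
      chord i {j} i<j j≤k a with d , eq ← m≤n⇒∃[o]m+o≡n i<j = go d eq
        where
        go : ∀ d → suc i + d ≡ j → j ≡ 1 + i ⊎ j ≡ 2 + i ⊎ 5 + m + i ≤ j
        go 0 eq = inj₁ (≡.trans (≡.sym eq) (+-identityʳ _))
        go 1 eq = inj₂ (inj₁ (≡.trans (≡.sym eq) (cong suc (+-comm i 1))))
        go (suc (suc d)) eq with 5 + d ≤? 6 + m
        ... | yes 5+d≤k = ⊥-elim (no-long-chord (m≤m+n 6 m) i d H
          (subst (_≤ 6 + m) eq′ j≤k) 5+d≤k (subst (λ l → p i ~ p l) eq′ a))
          where
          eq′ : j ≡ i + (3 + d)
          eq′ = ≡.trans (≡.sym eq) (≡.sym (+-suc i (2 + d)))
        ... | no 5+d≰k = inj₂ (inj₂ (subst (5 + m + i ≤_) (≡.trans (arith d i) eq)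
            (+-monoˡ-≤ i (s≤s⁻¹ (s≤s⁻¹ (≰⇒> 5+d≰k))))))
          where
          arith : ∀ d i → 3 + d + i ≡ suc i + (2 + d)
          arith = solve-∀

      row : ∀ i c → i + c ≡ 6 + m → (js : List ℕ) →
        (∀ {j} → i < j → j ≤ 6 + m → p i ~ p j → j ∈ js) →
        degree (adj G) (p i) (applyUpTo (λ l → p (suc (i + l))) c) ≤ length js
      row i c eq js sub = subst (_ ≤_) (length-map p js)
        (degree≤ (Unique.applyUpTo⁺₁ _ c uniq) (map p js) near)
        where
        bound : ∀ {l} → l < c → suc (i + l) ≤ 6 + m
        bound {l} l<c = subst (suc (i + l) ≤_) eq (subst (_≤ i + c) (+-suc i l) (+-monoʳ-≤ i l<c))
        uniq : ∀ {a b} → a < b → b < c → p (suc (i + a)) ≢ p (suc (i + b))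
        uniq a<b b<c same = <⇒≢ a<b (+-cancelˡ-≡ i _ _
          (suc-injective (injective P (bound (<-trans a<b b<c)) (bound b<c) same)))
        near : ∀ {x} → x ∈ applyUpTo (λ l → p (suc (i + l))) c → p i ~ x → x ∈ map p js
        near x∈ a with ∈-applyUpTo⁻ _ x∈
        ... | l , l<c , refl = ∈-map⁺ p (sub (s≤s (m≤m+n i l)) (bound l<c) a)

      inner : ∀ {i j} → 2 ≤ i → i < j → j ≤ 6 + m → p i ~ p j → j ∈ 1 + i ∷ 2 + i ∷ []
      inner {i} 2≤i i<j j≤k a with chord i i<j j≤k a
      ... | inj₁ eq        = here eq
      ... | inj₂ (inj₁ eq) = there (here eq)
      ... | inj₂ (inj₂ le) = ⊥-elim (<⇒≱
        (≤-trans (s≤s (≤-reflexive (arith m))) (+-monoʳ-≤ (5 + m) 2≤i)) (≤-trans le j≤k))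
        where
        arith : ∀ m → 6 + m ≡ 4 + m + 2
        arith = solve-∀

      row₀ : ∀ {j} → 0 < j → j ≤ 6 + m → p 0 ~ p j → j ∈ 1 ∷ 6 + m ∷ 2 ∷ 5 + m ∷ []
      row₀ {j} 0<j j≤k a with chord 0 0<j j≤k a
      ... | inj₁ eq        = here eq
      ... | inj₂ (inj₁ eq) = there (there (here eq))
      ... | inj₂ (inj₂ le) with m≤n⇒m<n∨m≡n j≤k
      ...   | inj₂ eq  = there (here eq)
      ...   | inj₁ j<k = there (there (there (here
        (≤-antisym (s≤s⁻¹ j<k) (subst (_≤ j) (+-identityʳ (5 + m)) le)))))

      row₁ : ∀ {j} → 1 < j → j ≤ 6 + m → p 1 ~ p j → j ∈ 2 ∷ 3 ∷ 6 + m ∷ []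
      row₁ {j} 1<j j≤k a with chord 1 1<j j≤k a
      ... | inj₁ eq        = here eq
      ... | inj₂ (inj₁ eq) = there (here eq)
      ... | inj₂ (inj₂ le) = there (there (here
        (≤-antisym j≤k (subst (_≤ j) (+-comm (5 + m) 1) le))))

      -- Three consecutive chords of length 2 always yield a spider: around a centre c on the cycle,
      -- the legs are c + 1, c + 3, then c + 2, c + 4, then c - 1, c - 2. Here c is 5 + m, and in
      -- `no-inner-chords` it is 2.
      no-outer-chords : p 0 ~ p 2 → p 0 ~ p (5 + m) → ¬ (p 1 ~ p (6 + m))
      no-outer-chords a b c = no-path-spider P
        {0 ∷ 1 ∷ 2 ∷ 3 + m ∷ 4 + m ∷ 5 + m ∷ 6 + m ∷ []}
        (≤-refl ∷ ≤-refl ∷ s≤s (s≤s (s≤s z≤n)) ∷ ≤-refl ∷ ≤-refl ∷ ≤-refl ∷ [ ≤-refl ])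
        (# 5 ∷ # 6 ∷ # 1 ∷ # 0 ∷ # 2 ∷ # 4 ∷ # 3 ∷ [])
        ( edge P ≤-refl ∷ ~-sym c ∷ ~-sym b ∷ a
        ∷ ~-sym (edge P (n≤1+n _))
        ∷ ~-sym (edge P (m≤n+m _ 2)) ∷ [])

      no-inner-chords : p 2 ~ p 4 → p 3 ~ p 5 → ¬ (p 4 ~ p 6)
      no-inner-chords a b c = no-path-spider P
        {0 ∷ 1 ∷ 2 ∷ 3 ∷ 4 ∷ 5 ∷ 6 ∷ []}
        (≤-refl ∷ ≤-refl ∷ ≤-refl ∷ ≤-refl ∷ ≤-refl ∷ ≤-refl ∷ [ m≤m+n 6 m ])
        (# 2 ∷ # 3 ∷ # 5 ∷ # 4 ∷ # 6 ∷ # 1 ∷ # 0 ∷ [])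
        ( edge P (s≤s (s≤s (s≤s z≤n))) ∷ b ∷ a ∷ c
        ∷ ~-sym (edge P (s≤s (s≤s z≤n)))
        ∷ ~-sym (edge P (s≤s z≤n)) ∷ [])

      tail : ℕ → List V
      tail i = applyUpTo (λ l → p (i + l)) (7 + m ∸ i)

      deg : ℕ → ℕ
      deg i = degree (adj G) (p i) (tail (suc i))

      outer-rows : deg 0 + deg 1 ≤ 6
      outer-rows with T? (adj G (p 0) (p 2)) | T? (adj G (p 0) (p (5 + m)))
      ... | no ¬a | _ = +-mono-≤
        (row 0 (6 + m) refl (1 ∷ 6 + m ∷ 5 + m ∷ []) λ 0<j j≤k a → drop a (row₀ 0<j j≤k a))
        (row 1 (5 + m) refl _ row₁)
        where
        drop : ∀ {j} → p 0 ~ p j → j ∈ 1 ∷ 6 + m ∷ 2 ∷ 5 + m ∷ [] → j ∈ 1 ∷ 6 + m ∷ 5 + m ∷ []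
        drop a (here eq)                   = here eq
        drop a (there (here eq))           = there (here eq)
        drop a (there (there (here refl))) = ⊥-elim (¬a a)
        drop a (there (there (there x)))   = there (there x)
      ... | yes _ | no ¬b = +-mono-≤
        (row 0 (6 + m) refl (1 ∷ 6 + m ∷ 2 ∷ []) λ 0<j j≤k a → drop a (row₀ 0<j j≤k a))
        (row 1 (5 + m) refl _ row₁)
        where
        drop : ∀ {j} → p 0 ~ p j → j ∈ 1 ∷ 6 + m ∷ 2 ∷ 5 + m ∷ [] → j ∈ 1 ∷ 6 + m ∷ 2 ∷ []
        drop a (here eq)                           = here eq
        drop a (there (here eq))                   = there (here eq)
        drop a (there (there (here eq)))           = there (there (here eq))
        drop a (there (there (there (here refl)))) = ⊥-elim (¬b a)
      ... | yes a | yes b = +-mono-≤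
        (row 0 (6 + m) refl _ row₀)
        (row 1 (5 + m) refl (2 ∷ 3 ∷ []) λ 1<j j≤k c → drop c (row₁ 1<j j≤k c))
        where
        drop : ∀ {j} → p 1 ~ p j → j ∈ 2 ∷ 3 ∷ 6 + m ∷ [] → j ∈ 2 ∷ 3 ∷ []
        drop c (here eq)                   = here eq
        drop c (there (here eq))           = there (here eq)
        drop c (there (there (here refl))) = ⊥-elim (no-outer-chords a b c)

      inner-row : ∀ i c → 2 ≤ i → i + c ≡ 6 + m →
        degree (adj G) (p i) (applyUpTo (λ l → p (suc (i + l))) c) ≤ 2
      inner-row i c 2≤i eq = row i c eq (1 + i ∷ 2 + i ∷ []) (inner 2≤i)

      short-row : ∀ i c → 2 ≤ i → i + c ≡ 6 + m → ¬ (p i ~ p (2 + i)) →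
        degree (adj G) (p i) (applyUpTo (λ l → p (suc (i + l))) c) ≤ 1
      short-row i c 2≤i eq ¬a = row i c eq (1 + i ∷ []) λ i<j j≤k a → drop a (inner 2≤i i<j j≤k a)
        where
        drop : ∀ {j} → p i ~ p j → j ∈ 1 + i ∷ 2 + i ∷ [] → j ∈ 1 + i ∷ []
        drop a (here eq)           = here eq
        drop a (there (here refl)) = ⊥-elim (¬a a)

      inner-rows : deg 2 + (deg 3 + deg 4) ≤ 5
      inner-rows with T? (adj G (p 2) (p 4)) | T? (adj G (p 3) (p 5))
      ... | no ¬a | _     = +-mono-≤ (short-row 2 _ 2≤2 refl ¬a)
        (+-mono-≤ (inner-row 3 _ 2≤3 refl) (inner-row 4 _ 2≤4 refl))
        where
        2≤2 = m≤m+n 2 0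
        2≤3 = m≤m+n 2 1
        2≤4 = m≤m+n 2 2
      ... | yes _ | no ¬b = +-mono-≤ (inner-row 2 _ (m≤m+n 2 0) refl)
        (+-mono-≤ (short-row 3 _ (m≤m+n 2 1) refl ¬b) (inner-row 4 _ (m≤m+n 2 2) refl))
      ... | yes a | yes b = +-mono-≤ (inner-row 2 _ (m≤m+n 2 0) refl)
        (+-mono-≤ (inner-row 3 _ (m≤m+n 2 1) refl)
          (short-row 4 _ (m≤m+n 2 2) refl (no-inner-chords a b)))

      tail-edges : e (tail 5) ≤ 1 + 2 * m
      tail-edges = band-edges m (λ l → p (5 + l))
        (Unique.applyUpTo⁺₁ _ (2 + m) λ a<b b<c same → <⇒≢ a<b
          (+-cancelˡ-≡ 5 _ _ (injective P (+-monoʳ-≤ 5 (<⇒≤ (≤-trans a<b (s≤s⁻¹ b<c))))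
            (+-monoʳ-≤ 5 (s≤s⁻¹ b<c)) same)))
        λ i d le → no-long-chord (m≤m+n 6 m) (5 + i) d H (+-monoʳ-≤ 5 le)
          (+-monoʳ-≤ 5 (≤-trans (m≤n+m d 3) (≤-trans (m≤n+m (3 + d) i) le)))

      -- With forward neighbours only, the rows 0 to 4 allow 4, 3, 2, 2, 2 edges and the rest 2m +
      -- 1, which is 2(7 + m) in total, the square of the cycle. Two disjoint triples of consecutive
      -- short chords each lack a member, and this saves the two edges.
      sparse : Sparse S
      sparse = ≤-trans
        (+-monoˡ-≤ 2 (≤-trans (≤-reflexive total)
          (+-mono-≤ outer-rows (+-mono-≤ inner-rows tail-edges))))
        (≤-reflexive (≡.trans (arith m) (cong (2 *_) (≡.sym size))))
        where
        size : length S ≡ 7 + m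
        size = ≡.trans (↭-length (closed-↭ H)) (length-applyUpTo p (7 + m))
        assoc : ∀ a b c d f g → a + (b + (c + (d + (f + g)))) ≡ (a + b) + ((c + (d + f)) + g)
        assoc = solve-∀
        total : e S ≡ (deg 0 + deg 1) + ((deg 2 + (deg 3 + deg 4)) + e (tail 5))
        total = ≡.trans (edges-↭ (sym G) (closed-↭ H))
          (assoc (deg 0) (deg 1) (deg 2) (deg 3) (deg 4) (e (tail 5)))
        arith : ∀ m → 6 + (5 + (1 + 2 * m)) + 2 ≡ 2 * (7 + m)
        arith = solve-∀

  -- Transferring the seven-vertex search to G

  lookup-injective : ∀ {xs : List V} → Unique xs → ∀ i j →
    List.lookup xs i ≡ List.lookup xs j → i ≡ j
  lookup-injective (x∉ ∷ u) zero    zero    eq = refl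
  lookup-injective (x∉ ∷ u) zero    (suc j) eq = ⊥-elim (All.lookup x∉ (∈-lookup j) eq)
  lookup-injective (x∉ ∷ u) (suc i) zero    eq = ⊥-elim (All.lookup x∉ (∈-lookup i) (≡.sym eq))
  lookup-injective (x∉ ∷ u) (suc i) (suc j) eq = cong suc (lookup-injective u i j eq)

  no-dense-seven : ∀ {a b c d f g h} → Unique (a ∷ b ∷ c ∷ d ∷ f ∷ g ∷ h ∷ []) → a ~ b →
    12 ≤ e (b ∷ c ∷ d ∷ f ∷ g ∷ h ∷ []) ⊎ (a ~ c × 11 ≤ e (b ∷ c ∷ d ∷ f ∷ g ∷ h ∷ [])) → ⊥
  no-dense-seven {a} {b} {c} {d} {f} {g} {h} u ab dense = embed
    ([ pendant-spider r-sym ab , (λ (ac , le) → cap-spider r-sym ab ac le) ]′ dense)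
    where
    vertex : Fin 7 → V
    vertex = List.lookup (a ∷ b ∷ c ∷ d ∷ f ∷ g ∷ h ∷ [])
    r-sym : ∀ i j → adj G (vertex i) (vertex j) ≡ adj G (vertex j) (vertex i)
    r-sym i j = sym G (vertex i) (vertex j)
    embed : ¬ Spider r-sym
    embed (s , inj , s-legs) = no-spider (λ i → vertex (lookup s i))
      (λ {i} {j} eq → inj i j (lookup-injective u _ _ eq)) s-legs

  two-elements : ∀ {xs : List V} → Unique xs → 2 ≤ length xs →
    ∃₂ λ a b → a ∈ xs × b ∈ xs × a ≢ b
  two-elements {_ ∷ []}    _                 (s≤s ())
  two-elements {a ∷ b ∷ _} ((a≢b ∷ _) ∷ _) _ = a , b , here refl , there (here refl) , a≢b

  -- The induction step: refuting a dense set

  module Induction {S : List V} (unique : Unique S) (connected : ConnectedOn S)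
    (7≤∣S∣ : 7 ≤ length S)
    (smaller : ∀ {S′} → Unique S′ → ConnectedOn S′ → 7 ≤ length S′ → length S′ < length S →
      Sparse S′)
    (dense : ¬ Sparse S)
    where

    open OnSet unique connected
    open Longest

    not-closed : ∀ {k p} → Longest k p → ¬ (p 0 ~ p k)
    not-closed {k} {p} L a = go (m≤n⇒∃[o]m+o≡n 6≤k)
      where
      6≤k : 6 ≤ k
      6≤k = s≤s⁻¹ (subst (7 ≤_) (≡.trans (↭-length (closed-↭ (L , ~-sym a)))
        (length-applyUpTo p (suc k))) 7≤∣S∣)
      go : ¬ ∃ λ m → 6 + m ≡ k
      go (m , refl) = dense (Hamiltonian.sparse (L , ~-sym a))

    path-∈ : ∀ {i j} → Path S k p → S ↭ p j ∷ S′ → j ≤ k → i ≤ k → j ≢ i → p i ∈ S′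
    path-∈ P S↭ j≤k i≤k j≢i = ∈-drop-head (∈-resp-↭ S↭ (inside P i≤k))
      λ eq → j≢i (injective P j≤k i≤k (≡.sym eq))

    -- The positions `a` and `b` serve only to bound the degree of `p 0`; they may coincide, or name
    -- positions that are not adjacent to `p 0` at all.
    no-low-end : 1 ≤ k → Longest k p →
      ∀ a b → ¬ (∀ {i} → i ≤ k → p 0 ~ p i → i ≡ a ⊎ i ≡ b)
    no-low-end {k} {p} 1≤k L a b ends =
      let S′ , S↭ = ∈⇒↭∷ (inside P z≤n) in remove S↭
      where
      P : Path S k p
      P = path L
      p₀~p₁ : p 0 ~ p 1
      p₀~p₁ = edge P 1≤k
      remove : ∀ {S′} → ¬ (S ↭ p 0 ∷ S′)
      remove {S′} S↭ with Unique-resp-↭ S↭ unique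
      ... | p₀∉ ∷ unique′ = by-size (7 ≤? length S′)
        where
        size : length S ≡ suc (length S′)
        size = ↭-length S↭
        later-∈ : ∀ {i} → 1 ≤ i → i ≤ k → p i ∈ S′
        later-∈ 1≤i i≤k = path-∈ P S↭ z≤n i≤k (<⇒≢ 1≤i)
        ∈S : ∀ {x} → x ∈ S′ → x ∈ S
        ∈S x∈ = ∈-resp-↭ (↭-sym S↭) (there x∈)
        connected′ : ConnectedOn S′
        connected′ = connected-remove connected S↭ (later-∈ 1≤k ≤-refl) detour
          where
          detour : ∀ {x} → x ∈ S′ → p 0 ~ x → Reach S′ x (p k)
          detour x∈ a with neighbour-on-path L (∈S x∈) a
          ... | i , 1≤i , i≤k , refl = path-reach P (k ∸ i) i (m+[n∸m]≡n i≤k)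
            λ i≤l → later-∈ (≤-trans 1≤i i≤l)
        end-∈ : ∀ {x} → x ∈ S′ → p 0 ~ x → x ∈ p a ∷ p b ∷ []
        end-∈ x∈ a with neighbour-on-path L (∈S x∈) a
        ... | i , 1≤i , i≤k , refl with ends i≤k a
        ...   | inj₁ refl = here refl
        ...   | inj₂ refl = there (here refl)
        degree≤2 : degree (adj G) (p 0) S′ ≤ 2
        degree≤2 = degree≤ {r = adj G} unique′ (p a ∷ p b ∷ []) end-∈
        e-split : e S ≡ degree (adj G) (p 0) S′ + e S′
        e-split = edges-↭ (sym G) S↭
        arith : ∀ l → 2 + 2 * l ≡ 2 * suc l
        arith = solve-∀
        -- On seven vertices, failing the bound means e + 2 ≥ 15.
        dense-six : length S′ ≡ 6 → 13 ≤ degree (adj G) (p 0) S′ + e S′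
        dense-six six = +-cancelʳ-≤ 2 _ _ (subst (λ E → 15 ≤ E + 2) e-split
          (subst (λ l → suc (2 * l) ≤ e S + 2) (≡.trans size (cong suc six)) (≰⇒> dense)))
        by-size : Dec (7 ≤ length S′) → ⊥
        by-size (yes 7≤∣S′∣) = dense (subst (λ E → E + 2 ≤ 2 * length S) (≡.sym e-split)
          (subst (_≤ 2 * length S) (≡.sym (+-assoc (degree (adj G) (p 0) S′) _ 2))
            (≤-trans (+-mono-≤ degree≤2
                (smaller unique′ connected′ 7≤∣S′∣ (≤-reflexive (≡.sym size))))
              (≤-reflexive (≡.trans (arith (length S′)) (cong (2 *_) (≡.sym size)))))))
        by-size (no 7≰∣S′∣) = second (Any.any? (λ y → T? (adj G (p 0) y) ×-dec ¬? (y ≟ᶠ p 1)) S′)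
          where
          six : length S′ ≡ 6
          six = ≤-antisym (s≤s⁻¹ (≰⇒> 7≰∣S′∣)) (s≤s⁻¹ (subst (7 ≤_) size 7≤∣S∣))
          finish : ∀ {R} → length R ≡ 6 → Unique (p 0 ∷ R) → (∃ λ R′ → R ≡ p 1 ∷ R′) →
            12 ≤ e R ⊎ (∃₂ λ y R′ → R ≡ p 1 ∷ y ∷ R′ × p 0 ~ y × 11 ≤ e R) → ⊥
          finish {_ ∷ _ ∷ _ ∷ _ ∷ _ ∷ _ ∷ []} _ u (_ , refl) (inj₁ le) =
            no-dense-seven u p₀~p₁ (inj₁ le)
          finish {_ ∷ _ ∷ _ ∷ _ ∷ _ ∷ _ ∷ []} _ u (_ , refl) (inj₂ (_ , _ , refl , a , le)) =
            no-dense-seven u p₀~p₁ (inj₂ (a , le))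
          resp : ∀ {R} → S′ ↭ R → length R ≡ 6 × Unique (p 0 ∷ R)
          resp S′↭ = ≡.trans (≡.sym (↭-length S′↭)) six ,
            Unique-resp-↭ (↭-trans S↭ (↭.prep _ S′↭)) unique
          edges-via : ∀ {R} d → S′ ↭ R → degree (adj G) (p 0) S′ ≤ d → 13 ≤ d + e R
          edges-via d S′↭ le = ≤-trans (dense-six six)
            (+-mono-≤ le (≤-reflexive (edges-↭ (sym G) S′↭)))
          -- Of the 13 edges, a single neighbour leaves 12 among the other six vertices. A second
          -- neighbour leaves only 11, but it supplies the extra edge that `cap-spider` needs.
          second : Dec (Any (λ y → p 0 ~ y × y ≢ p 1) S′) → ⊥
          second (no none) =
            let R , S′↭ = ∈⇒↭∷ (later-∈ ≤-refl 1≤k)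
                len , u = resp S′↭
            in finish len u (R , refl) (inj₁ (s≤s⁻¹ (edges-via 1 S′↭
                 (degree≤ {r = adj G} unique′ (p 1 ∷ []) only))))
            where
            only : ∀ {x} → x ∈ S′ → p 0 ~ x → x ∈ p 1 ∷ []
            only {x} x∈ a with x ≟ᶠ p 1
            ... | yes eq = here eq
            ... | no  ≢  = ⊥-elim (none (lose x∈ (a , ≢)))
          second (yes some) with find some
          ... | y , y∈ , a , y≢p₁ =
            let zs , S′↭ = unique-⊆⇒↭++ ((y≢p₁ ∘ ≡.sym ∷ []) ∷ [] ∷ [])
                             (later-∈ ≤-refl 1≤k ∷ y∈ ∷ [])
                len , u = resp S′↭
            in finish len u (_ , refl) (inj₂ (y , zs , refl , a ,
                 s≤s⁻¹ (s≤s⁻¹ (edges-via 2 S′↭ degree≤2))))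

    -- The rotated longest path runs from `p 1` to `p k`, and its ends may not be adjacent. Matching
    -- on the bound exposes enough of `k` for `reverse₂` to leave it fixed by computation.
    crossing₂ : 2 ≤ k → Longest k p → p 0 ~ p 2 → ¬ (p 1 ~ p k)
    crossing₂ {p = p} 2≤k@(s≤s (s≤s _)) L a b = not-closed (reverse₂-longest 2≤k L a) b

    crossing₃ : 3 ≤ k → Longest k p → p 0 ~ p 3 → ¬ (p 2 ~ p k)
    crossing₃ {p = p} 3≤k@(s≤s (s≤s (s≤s _))) L a b = not-closed (reverse₃-longest 3≤k L a) b

    -- The penultimate position `k` survives because `no-middle-chord` needs two path vertices
    -- beyond the chord.
    end-neighbour : Longest (suc k) p → ∀ {i} → i ≤ suc k → p 0 ~ p i →
      i ≡ 1 ⊎ i ≡ 2 ⊎ i ≡ 3 ⊎ i ≡ k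
    end-neighbour L {0} _ a = ⊥-elim (~-irrefl a)
    end-neighbour L {1} _ _ = inj₁ refl
    end-neighbour L {2} _ _ = inj₂ (inj₁ refl)
    end-neighbour L {3} _ _ = inj₂ (inj₂ (inj₁ refl))
    end-neighbour {k} L {suc (suc (suc (suc j)))} i≤k a with m≤n⇒m<n∨m≡n i≤k
    ... | inj₂ refl = ⊥-elim (not-closed L a)
    ... | inj₁ i<k with m≤n⇒m<n∨m≡n (s≤s⁻¹ i<k)
    ...   | inj₂ eq   = inj₂ (inj₂ (inj₂ eq))
    ...   | inj₁ i<k′ = ⊥-elim (no-middle-chord (path L) j (s≤s i<k′) a)

    -- If at most one of the three chords were present, that chord and the edge to `p 1` would be
    -- all that `p 0` has, contrary to `no-low-end`.
    two-chords : Longest (suc k) p →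
      (p 0 ~ p 2 × p 0 ~ p 3) ⊎ (p 0 ~ p 2 × p 0 ~ p k) ⊎ (p 0 ~ p 3 × p 0 ~ p k)
    two-chords {k} {p} L 
      with T? (adj G (p 0) (p 2)) | T? (adj G (p 0) (p 3)) | T? (adj G (p 0) (p k))
    ... | yes a | yes b | _     = inj₁ (a , b)
    ... | yes a | no  _ | yes c = inj₂ (inj₁ (a , c))
    ... | no  _ | yes b | yes c = inj₂ (inj₂ (b , c))
    ... | yes a | no ¬b | no ¬c = ⊥-elim (no-low-end (s≤s z≤n) L 1 2
      λ i≤k x → only (end-neighbour L i≤k x) x)
      where
      only : ∀ {i} → i ≡ 1 ⊎ i ≡ 2 ⊎ i ≡ 3 ⊎ i ≡ k → p 0 ~ p i → i ≡ 1 ⊎ i ≡ 2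
      only (inj₁ eq) x = inj₁ eq
      only (inj₂ (inj₁ eq)) x = inj₂ eq
      only (inj₂ (inj₂ (inj₁ refl))) x = ⊥-elim (¬b x)
      only (inj₂ (inj₂ (inj₂ refl))) x = ⊥-elim (¬c x)
    ... | no ¬a | yes b | no ¬c = ⊥-elim (no-low-end (s≤s z≤n) L 1 3
      λ i≤k x → only (end-neighbour L i≤k x) x)
      where
      only : ∀ {i} → i ≡ 1 ⊎ i ≡ 2 ⊎ i ≡ 3 ⊎ i ≡ k → p 0 ~ p i → i ≡ 1 ⊎ i ≡ 3
      only (inj₁ eq) x = inj₁ eq
      only (inj₂ (inj₁ refl)) x = ⊥-elim (¬a x)
      only (inj₂ (inj₂ (inj₁ eq))) x = inj₂ eq
      only (inj₂ (inj₂ (inj₂ refl))) x = ⊥-elim (¬c x)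
    ... | no ¬a | no ¬b | _ = ⊥-elim (no-low-end (s≤s z≤n) L 1 k
      λ i≤k x → only (end-neighbour L i≤k x) x)
      where
      only : ∀ {i} → i ≡ 1 ⊎ i ≡ 2 ⊎ i ≡ 3 ⊎ i ≡ k → p 0 ~ p i → i ≡ 1 ⊎ i ≡ k
      only (inj₁ eq) x = inj₁ eq
      only (inj₂ (inj₁ refl)) x = ⊥-elim (¬a x)
      only (inj₂ (inj₂ (inj₁ refl))) x = ⊥-elim (¬b x)
      only (inj₂ (inj₂ (inj₂ eq))) x = inj₂ eq

    -- Up to length 3 an end has at most two possible neighbours. At lengths 4 and 5 both ends need
    -- chords, and these are forced to cross.
    longest-long : 1 ≤ k → Longest k p → 6 ≤ k
    longest-long {1} _ L = ⊥-elim (no-low-end ≤-refl L 0 1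
      λ { {0} _ _ → inj₁ refl ; {1} _ _ → inj₂ refl ; {suc (suc _)} (s≤s ()) _ })
    longest-long {2} _ L = ⊥-elim (no-low-end (s≤s z≤n) L 1 2
      λ { {0} _ a → ⊥-elim (~-irrefl a) ; {1} _ _ → inj₁ refl ; {2} _ _ → inj₂ refl
        ; {suc (suc (suc _))} (s≤s (s≤s ())) _ })
    longest-long {3} _ L = ⊥-elim (no-low-end (s≤s z≤n) L 1 2
      λ { {0} _ a → ⊥-elim (~-irrefl a) ; {1} _ _ → inj₁ refl ; {2} _ _ → inj₂ refl
        ; {3} _ a → ⊥-elim (not-closed L a)
        ; {suc (suc (suc (suc _)))} (s≤s (s≤s (s≤s ()))) _ })
    longest-long {4} {p} _ L with T? (adj G (p 0) (p 2)) | T? (adj G (p 4) (p 1))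
    ... | yes a | yes b = ⊥-elim (crossing₂ (s≤s (s≤s z≤n)) L a (~-sym b))
    ... | no ¬a | _     = ⊥-elim (no-low-end (s≤s z≤n) L 1 3
      λ i≤4 x → only (end-neighbour L i≤4 x) x)
      where
      only : ∀ {i} → i ≡ 1 ⊎ i ≡ 2 ⊎ i ≡ 3 ⊎ i ≡ 3 → p 0 ~ p i → i ≡ 1 ⊎ i ≡ 3
      only (inj₁ eq)                 x = inj₁ eq
      only (inj₂ (inj₁ refl))        x = ⊥-elim (¬a x)
      only (inj₂ (inj₂ (inj₁ eq)))   x = inj₂ eq
      only (inj₂ (inj₂ (inj₂ eq)))   x = inj₂ eq
    ... | yes _ | no ¬b = ⊥-elim (no-low-end (s≤s z≤n) L′ 1 2
      λ i≤4 x → only (end-neighbour L′ i≤4 x) x)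
      where
      L′ : Longest 4 (reverse 4 p)
      L′ = reverse-longest L
      only : ∀ {i} → i ≡ 1 ⊎ i ≡ 2 ⊎ i ≡ 3 ⊎ i ≡ 3 → p 4 ~ reverse 4 p i → i ≡ 1 ⊎ i ≡ 2
      only (inj₁ eq)                 x = inj₁ eq
      only (inj₂ (inj₁ eq))          x = inj₂ eq
      only (inj₂ (inj₂ (inj₁ refl))) x = ⊥-elim (¬b x)
      only (inj₂ (inj₂ (inj₂ refl))) x = ⊥-elim (¬b x)
    -- A chord from `p 0` to position i, for i = 2, 3, 4, forbids one from `p 5` to i - 1. Two
    -- chords at `p 0` thus leave `p 5` only one of its three, and it needs two.
    longest-long {5} {p} _ L = ⊥-elim (clash (two-chords L) (two-chords (reverse-longest L)))
      where
      cross₂ : p 0 ~ p 2 → ¬ (p 5 ~ p 1)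
      cross₂ a b = crossing₂ (s≤s (s≤s z≤n)) L a (~-sym b)
      cross₃ : p 0 ~ p 3 → ¬ (p 5 ~ p 2)
      cross₃ a b = crossing₃ (s≤s (s≤s (s≤s z≤n))) L a (~-sym b)
      cross₄ : p 0 ~ p 4 → ¬ (p 5 ~ p 3)
      cross₄ a b = crossing₂ (s≤s (s≤s z≤n)) (reverse-longest L) b (~-sym a)
      clash : (p 0 ~ p 2 × p 0 ~ p 3) ⊎ (p 0 ~ p 2 × p 0 ~ p 4) ⊎ (p 0 ~ p 3 × p 0 ~ p 4) →
        ¬ ((p 5 ~ p 3 × p 5 ~ p 2) ⊎ (p 5 ~ p 3 × p 5 ~ p 1) ⊎ (p 5 ~ p 2 × p 5 ~ p 1))
      clash (inj₁ (a , b))        (inj₁ (x , y))        = cross₃ b y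
      clash (inj₁ (a , b))        (inj₂ (inj₁ (x , y))) = cross₂ a y
      clash (inj₁ (a , b))        (inj₂ (inj₂ (x , y))) = cross₂ a y
      clash (inj₂ (inj₁ (a , b))) (inj₁ (x , y))        = cross₄ b x
      clash (inj₂ (inj₁ (a , b))) (inj₂ (inj₁ (x , y))) = cross₂ a y
      clash (inj₂ (inj₁ (a , b))) (inj₂ (inj₂ (x , y))) = cross₂ a y
      clash (inj₂ (inj₂ (a , b))) (inj₁ (x , y))        = cross₃ a y
      clash (inj₂ (inj₂ (a , b))) (inj₂ (inj₁ (x , y))) = cross₄ b x
      clash (inj₂ (inj₂ (a , b))) (inj₂ (inj₂ (x , y))) = cross₃ a x
    longest-long {suc (suc (suc (suc (suc (suc k)))))} _ _ = m≤m+n 6 k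

    -- Together with a chord to `p 3` this chord makes `p 0` the centre of a spider, so the other
    -- chord at `p 0` goes to `p 2`. The far end also has two chords: one to `p (4 + j)` crosses the
    -- assumed chord, one to `p 1` crosses the chord to `p 2`, and only one possibility is left.
    no-penultimate : ∀ {j} → Longest (6 + j) p → ¬ (p 0 ~ p (5 + j))
    no-penultimate {p} {j} L c = cases (two-chords L) (two-chords (reverse-longest L))
      where
      P : Path S (6 + j) p
      P = path L
      spread : ¬ (p 0 ~ p 3)
      spread b = no-path-spider P {0 ∷ 1 ∷ 2 ∷ 3 ∷ 4 ∷ 5 + j ∷ 6 + j ∷ []}
        (≤-refl ∷ ≤-refl ∷ ≤-refl ∷ ≤-refl ∷ m≤m+n 5 j ∷ ≤-refl ∷ [ ≤-refl ])
        (# 0 ∷ # 1 ∷ # 2 ∷ # 3 ∷ # 4 ∷ # 5 ∷ # 6 ∷ [])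
        ( edge P (m≤m+n 1 (5 + j)) ∷ edge P (m≤m+n 2 (4 + j))
        ∷ b ∷ edge P (m≤m+n 4 (2 + j))
        ∷ c ∷ edge P ≤-refl ∷ [])
      mirror₂ : ¬ (p (6 + j) ~ p (4 + j))
      mirror₂ b = crossing₂ (m≤m+n 2 (4 + j)) (reverse-longest L) b
        (subst (λ l → p (5 + j) ~ p l) (≡.sym (n∸n≡0 j)) (~-sym c))
      mirror₁ : p 0 ~ p 2 → ¬ (p (6 + j) ~ reverse (6 + j) p (5 + j))
      mirror₁ a b = crossing₂ (m≤m+n 2 (4 + j)) L a
        (~-sym (subst (λ l → p (6 + j) ~ p l) (m+n∸n≡m 1 j) b))
      cases : (p 0 ~ p 2 × p 0 ~ p 3) ⊎ (p 0 ~ p 2 × p 0 ~ p (5 + j)) ⊎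
        (p 0 ~ p 3 × p 0 ~ p (5 + j)) →
        ¬ ((p (6 + j) ~ p (4 + j) × p (6 + j) ~ p (3 + j)) ⊎
           (p (6 + j) ~ p (4 + j) × p (6 + j) ~ reverse (6 + j) p (5 + j)) ⊎
           (p (6 + j) ~ p (3 + j) × p (6 + j) ~ reverse (6 + j) p (5 + j)))
      cases (inj₁ (_ , b))        _                     = spread b
      cases (inj₂ (inj₂ (b , _))) _                     = spread b
      cases (inj₂ (inj₁ _))       (inj₁ (b , _))        = mirror₂ b
      cases (inj₂ (inj₁ _))       (inj₂ (inj₁ (b , _))) = mirror₂ b
      cases (inj₂ (inj₁ (a , _))) (inj₂ (inj₂ (_ , b))) = mirror₁ a b

    end-chords : ∀ {j} → Longest (6 + j) p → p 0 ~ p 2 × p 0 ~ p 3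
    end-chords L with two-chords L
    ... | inj₁ ab             = ab
    ... | inj₂ (inj₁ (_ , c)) = ⊥-elim (no-penultimate L c)
    ... | inj₂ (inj₂ (_ , c)) = ⊥-elim (no-penultimate L c)

    end-neighbours : ∀ {j} → Longest (6 + j) p → ∀ {x} → x ∈ S → p 0 ~ x → x ∈ p 1 ∷ p 2 ∷ p 3 ∷ []
    end-neighbours L x∈ a with neighbour-on-path L x∈ a
    ... | i , _ , i≤k , refl with end-neighbour L i≤k a
    ...   | inj₁ refl               = here refl
    ...   | inj₂ (inj₁ refl)        = there (here refl)
    ...   | inj₂ (inj₂ (inj₁ refl)) = there (there (here refl))
    ...   | inj₂ (inj₂ (inj₂ refl)) = ⊥-elim (no-penultimate L a)

    -- Reversing the first two or three vertices gives longest paths again, so end-neighbours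
    -- applies to p 1 and p 2 too: p 0, p 1, p 2, p 3 span a K₄ attached to the rest at p 3 only.
    module End {j : ℕ} {p : ℕ → V} (L : Longest (6 + j) p) where

      private
        P : Path S (6 + j) p
        P = path L

      N₀ : ∀ {x} → x ∈ S → p 0 ~ x → x ∈ p 1 ∷ p 2 ∷ p 3 ∷ []
      N₀ = end-neighbours L

      N₁ : ∀ {x} → x ∈ S → p 1 ~ x → x ∈ p 0 ∷ p 2 ∷ p 3 ∷ []
      N₁ = end-neighbours (reverse₂-longest (m≤m+n 2 (4 + j)) L (proj₁ (end-chords L)))

      N₂ : ∀ {x} → x ∈ S → p 2 ~ x → x ∈ p 1 ∷ p 0 ∷ p 3 ∷ []
      N₂ = end-neighbours (reverse₃-longest (m≤m+n 3 (3 + j)) L (proj₂ (end-chords L)))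

      distinct : Unique (p 0 ∷ p 1 ∷ p 2 ∷ [])
      distinct = (apart 0 1 z≤n (m≤m+n 1 _) (λ ()) ∷ apart 0 2 z≤n (m≤m+n 2 _) (λ ()) ∷ [])
        ∷ (apart 1 2 (m≤m+n 1 _) (m≤m+n 2 _) (λ ()) ∷ []) ∷ [] ∷ []
        where
        apart : ∀ a b → a ≤ 6 + j → b ≤ 6 + j → a ≢ b → p a ≢ p b
        apart a b a≤k b≤k a≢b eq = a≢b (injective P a≤k b≤k eq)

      N₁′ : ∀ {R} → Unique (p 0 ∷ p 1 ∷ p 2 ∷ R) → (∀ {x} → x ∈ R → x ∈ S) →
        ∀ {x} → x ∈ p 2 ∷ R → p 1 ~ x → x ∈ p 2 ∷ p 3 ∷ []
      N₁′ {R} (p₀∉ ∷ _) R⊆S x∈ a with N₁ (∈S x∈) a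
        where
        ∈S : ∀ {x} → x ∈ p 2 ∷ R → x ∈ S
        ∈S (here refl) = inside P (m≤m+n 2 _)
        ∈S (there x∈)  = R⊆S x∈
      ... | here refl = ⊥-elim (All.lookup p₀∉ (there x∈) refl)
      ... | there x∈′ = x∈′

      N₂′ : ∀ {R} → Unique (p 0 ∷ p 1 ∷ p 2 ∷ R) → (∀ {x} → x ∈ R → x ∈ S) →
        ∀ {x} → x ∈ R → p 2 ~ x → x ∈ p 3 ∷ []
      N₂′ (p₀∉ ∷ p₁∉ ∷ _) R⊆S x∈ a with N₂ (R⊆S x∈) a
      ... | here refl         = ⊥-elim (All.lookup p₁∉ (there x∈) refl)
      ... | there (here refl) = ⊥-elim (All.lookup p₀∉ (there (there x∈)) refl)
      ... | there (there x∈′) = x∈′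

      -- The edges of the K₄ as 3 + 2 + 1, each charged to the first of the free vertices that it
      -- meets.
      end-edges : ∀ {R} → Unique (p 0 ∷ p 1 ∷ p 2 ∷ R) → (∀ {x} → x ∈ R → x ∈ S) →
        e (p 0 ∷ p 1 ∷ p 2 ∷ R) ≤ 6 + e R
      end-edges {R} u@(_ ∷ u₁@(_ ∷ u₂@(_ ∷ u₃))) R⊆S =
        +-mono-≤ (degree≤ {r = adj G} u₁ (p 1 ∷ p 2 ∷ p 3 ∷ []) λ x∈ → N₀ (∈S x∈))
          (+-mono-≤ (degree≤ {r = adj G} u₂ (p 2 ∷ p 3 ∷ []) (N₁′ u R⊆S))
            (+-monoˡ-≤ (e R) (degree≤ {r = adj G} u₃ (p 3 ∷ []) (N₂′ u R⊆S))))
        where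
        ∈S : ∀ {x} → x ∈ p 1 ∷ p 2 ∷ R → x ∈ S
        ∈S (here refl)         = inside P (m≤m+n 1 _)
        ∈S (there (here refl)) = inside P (m≤m+n 2 _)
        ∈S (there (there x∈))  = R⊆S x∈

      later-∈-rest : ∀ {R} → S ↭ p 0 ∷ p 1 ∷ p 2 ∷ R → ∀ l → 3 + l ≤ 6 + j → p (3 + l) ∈ R
      later-∈-rest S↭ l le = ∈-drop-head (∈-drop-head (∈-drop-head
        (∈-resp-↭ S↭ (inside P le)) (apart z≤n λ ())) (apart (m≤m+n 1 _) λ ()))
        (apart (m≤m+n 2 _) λ ())
        where
        apart : ∀ {a} → a ≤ 6 + j → 3 + l ≢ a → p (3 + l) ≢ p a
        apart a≤k ≢ eq = ≢ (injective P le a≤k eq)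

      -- The free vertices go one at a time; after each removal the former neighbours still reach
      -- the far end along what remains of the path.
      rest-connected : ∀ {R} → S ↭ p 0 ∷ p 1 ∷ p 2 ∷ R → ConnectedOn R
      rest-connected {R} S↭ =
        connected-remove
          (connected-remove
            (connected-remove connected S↭ (there (there last∈)) λ x∈ a →
              reach₁ (N₀ (∈S (there x∈)) a))
            ↭.refl (there last∈) λ x∈ a → reach₂ (N₁′ R-apart R⊆S x∈ a))
          ↭.refl last∈ λ x∈ a → reach₃ (N₂′ R-apart R⊆S x∈ a)
        where
        ∈S : ∀ {x} → x ∈ p 0 ∷ p 1 ∷ p 2 ∷ R → x ∈ S
        ∈S = ∈-resp-↭ (↭-sym S↭)
        R⊆S : ∀ {x} → x ∈ R → x ∈ S
        R⊆S x∈ = ∈S (there (there (there x∈)))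
        R-apart : Unique (p 0 ∷ p 1 ∷ p 2 ∷ R)
        R-apart = Unique-resp-↭ S↭ unique
        last∈ : p (6 + j) ∈ R
        last∈ = later-∈-rest S↭ (3 + j) ≤-refl
        later₃ : ∀ {l} → 3 ≤ l → l ≤ 6 + j → p l ∈ R
        later₃ (s≤s (s≤s (s≤s _))) le = later-∈-rest S↭ _ le
        later₂ : ∀ {l} → 2 ≤ l → l ≤ 6 + j → p l ∈ p 2 ∷ R
        later₂ {suc (suc zero)}    (s≤s (s≤s _)) _  = here refl
        later₂ {suc (suc (suc l))} (s≤s (s≤s _)) le = there (later-∈-rest S↭ l le)
        later₁ : ∀ {l} → 1 ≤ l → l ≤ 6 + j → p l ∈ p 1 ∷ p 2 ∷ R
        later₁ {suc zero}    _ _  = here refl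
        later₁ {suc (suc l)} _ le = there (later₂ (s≤s (s≤s z≤n)) le)
        reach₃ : ∀ {x} → x ∈ p 3 ∷ [] → Reach R x (p (6 + j))
        reach₃ (here refl) = path-reach P (3 + j) 3 refl later₃
        reach₂ : ∀ {x} → x ∈ p 2 ∷ p 3 ∷ [] → Reach (p 2 ∷ R) x (p (6 + j))
        reach₂ (here refl)         = path-reach P (4 + j) 2 refl later₂
        reach₂ (there (here refl)) = path-reach P (3 + j) 3 refl λ le → later₂ (<⇒≤ le)
        reach₁ : ∀ {x} → x ∈ p 1 ∷ p 2 ∷ p 3 ∷ [] → Reach (p 1 ∷ p 2 ∷ R) x (p (6 + j))
        reach₁ (here refl)                 = path-reach P (5 + j) 1 refl later₁
        reach₁ (there (here refl))         = path-reach P (4 + j) 2 refl λ le → later₁ (<⇒≤ le)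
        reach₁ (there (there (here refl))) =
          path-reach P (3 + j) 3 refl λ le → later₁ (<⇒≤ (<⇒≤ le))

    no-longest : ∀ {j} → ¬ Longest (6 + j) p
    no-longest {p} {j} L
      with R , S↭ ← unique-⊆⇒↭++ (End.distinct L)
        (inside (path L) z≤n ∷ inside (path L) (m≤m+n 1 _) ∷ inside (path L) (m≤m+n 2 _) ∷ [])
      with 7 ≤? length R
    ... | yes 7≤∣R∣ = dense (subst (_≤ 2 * length S) (cong (_+ 2) (≡.sym e-S))
      (≤-trans (+-monoˡ-≤ 2 (End.end-edges L R-apart R⊆S))
        (≤-trans (+-monoʳ-≤ 6 R-sparse)
          (≤-reflexive (≡.trans (arith (length R)) (cong (2 *_) (≡.sym size)))))))
      where
      R-apart : Unique (p 0 ∷ p 1 ∷ p 2 ∷ R)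
      R-apart = Unique-resp-↭ S↭ unique
      R⊆S : ∀ {x} → x ∈ R → x ∈ S
      R⊆S x∈ = ∈-resp-↭ (↭-sym S↭) (there (there (there x∈)))
      e-S : e S ≡ e (p 0 ∷ p 1 ∷ p 2 ∷ R)
      e-S = edges-↭ (sym G) S↭
      size : length S ≡ 3 + length R
      size = ↭-length S↭
      R-unique : Unique R
      R-unique with _ ∷ _ ∷ _ ∷ u₃ ← R-apart = u₃
      R-sparse : Sparse R
      R-sparse = smaller R-unique (End.rest-connected L S↭) 7≤∣R∣
        (subst (suc (length R) ≤_) (≡.sym size) (s≤s (m≤n+m (length R) 2)))
      arith : ∀ l → 6 + 2 * l ≡ 2 * (3 + l)
      arith = solve-∀
    ... | no 7≰∣R∣ = dense (subst (_≤ 2 * length S) (cong (_+ 2) (≡.sym (edges-↭ (sym G) S↭)))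
      (≤-trans (+-monoˡ-≤ 2 (End.end-edges L R-apart R⊆S)) small))
      where
      L′ : Longest (6 + j) (reverse (6 + j) p)
      L′ = reverse-longest L
      R-apart : Unique (p 0 ∷ p 1 ∷ p 2 ∷ R)
      R-apart = Unique-resp-↭ S↭ unique
      R⊆S : ∀ {x} → x ∈ R → x ∈ S
      R⊆S x∈ = ∈-resp-↭ (↭-sym S↭) (there (there (there x∈)))
      size : length S ≡ 3 + length R
      size = ↭-length S↭
      R-unique : Unique R
      R-unique with _ ∷ _ ∷ _ ∷ u₃ ← R-apart = u₃
      -- Here z counts the vertices outside both sets of free vertices. The case z = 1 is tight: two
      -- K₄ sharing a vertex have 12 edges on seven vertices.
      few : ∀ z → 7 ≤ 6 + z → 3 + z < 7 → 12 + triangular z + 2 ≤ 2 * (6 + z)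
      few 0 (s≤s (s≤s (s≤s (s≤s (s≤s (s≤s ())))))) _
      few 1 _ _ = ≤ᵇ⇒≤ _ _ tt
      few 2 _ _ = ≤ᵇ⇒≤ _ _ tt
      few 3 _ _ = ≤ᵇ⇒≤ _ _ tt
      few (suc (suc (suc (suc z)))) _ (s≤s (s≤s (s≤s (s≤s (s≤s (s≤s (s≤s ())))))))
      -- The last three path vertices, at positions 4 + j and above, are untouched by the first
      -- deletion and are the free vertices of the reversed path.
      small : 6 + e R + 2 ≤ 2 * length S
      small with Z , R↭ ← unique-⊆⇒↭++ (End.distinct L′)
        (End.later-∈-rest L S↭ (3 + j) ≤-refl ∷ End.later-∈-rest L S↭ (2 + j) (n≤1+n _)
          ∷ End.later-∈-rest L S↭ (1 + j) (m≤n+m _ 2) ∷ []) =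
        ≤-trans (+-monoˡ-≤ 2 (+-monoʳ-≤ 6 e-R))
          (subst (λ l → 12 + triangular (length Z) + 2 ≤ 2 * l) (≡.sym size′)
            (few (length Z) (subst (7 ≤_) size′ 7≤∣S∣) (subst (_< 7) (↭-length R↭) (≰⇒> 7≰∣R∣))))
        where
        size′ : length S ≡ 6 + length Z
        size′ = ≡.trans size (cong (3 +_) (↭-length R↭))
        e-R : e R ≤ 6 + triangular (length Z)
        e-R = ≤-trans (≤-reflexive (edges-↭ (sym G) R↭))
          (≤-trans (End.end-edges L′ (Unique-resp-↭ R↭ R-unique)
              λ x∈ → R⊆S (∈-resp-↭ (↭-sym R↭) (there (there (there x∈)))))
            (+-monoʳ-≤ 6 (edges≤triangular {r = adj G} Z)))

    -- Descending induction on the length takes the place of choosing a longest path. Paths that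
    -- need more than |S| vertices do not exist; once length `suc k` is excluded, a path of length
    -- `k` is longest, and that is contradictory.
    no-path : ∀ fuel {k p} → 1 ≤ k → length S ≤ k + fuel → ¬ Path S k p
    no-path zero {k} _ le P =
      <⇒≱ (path-length P) (subst (length S ≤_) (+-identityʳ k) le)
    no-path (suc fuel) {k} {p} 1≤k le P = finish (m≤n⇒∃[o]m+o≡n (longest-long 1≤k L)) L
      where
      L : Longest k p
      L = longest P (no-path fuel (s≤s z≤n) (subst (length S ≤_) (+-suc k fuel) le))
      finish : (∃ λ j → 6 + j ≡ k) → ¬ Longest k p
      finish (j , refl) = no-longest

    absurd : ⊥
    absurd with a , b , a∈ , b∈ , a≢b ← two-elements unique (≤-trans (m≤m+n 2 5) 7≤∣S∣) =
      start a∈ a≢b (connected a∈ b∈)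
      where
      start : ∀ {a b} → a ∈ S → a ≢ b → ¬ Reach S a b
      start a∈ a≢b done = a≢b refl
      start a∈ a≢b (step {v = w} a~w w∈ _) = no-path (length S) ≤-refl (n≤1+n _)
        (extend-path {k = 0} {p = λ _ → w}
          (record { inside = λ _ → w∈ ; injective = λ { z≤n z≤n _ → refl } ; edge = λ () })
          a∈ (λ _ → ~⇒≢ a~w) a~w)

  -- Strong induction and the upper bound

  sparse-within : ∀ N {S} → Unique S → ConnectedOn S → 7 ≤ length S → length S ≤ N → Sparse S
  sparse-within zero _ _ 7≤∣S∣ ∣S∣≤0 = ⊥-elim (<⇒≱ (≤-trans (s≤s z≤n) 7≤∣S∣) ∣S∣≤0)
  sparse-within (suc N) {S} unique connected 7≤∣S∣ ∣S∣≤N with e S + 2 ≤? 2 * length S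
  ... | yes sparse = sparse
  ... | no  dense  = ⊥-elim (Induction.absurd unique connected 7≤∣S∣
    (λ u c 7≤ lt → sparse-within N u c 7≤ (s≤s⁻¹ (≤-trans lt ∣S∣≤N))) dense)

  sparse-graph : Connected G → 7 ≤ n → e (allFin n) ≤ 2 * n ∸ 2
  sparse-graph connected 7≤n = subst (λ m → e (allFin n) ≤ 2 * m ∸ 2) size
    (m+n≤o⇒m≤o∸n _ (sparse-within n (Unique.allFin⁺ n) connectedOn
      (subst (7 ≤_) (≡.sym size) 7≤n) (≤-reflexive size)))
    where
    size : length (allFin n) ≡ n
    size = length-tabulate id
    walk⇒reach : ∀ {u v} → Walk G u v → Reach (allFin n) u v
    walk⇒reach []      = done
    walk⇒reach (x ∷ w) = step x (∈-allFin _) (walk⇒reach w)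
    connectedOn : ConnectedOn (allFin n)
    connectedOn _ _ = walk⇒reach (connected _ _)

-- Edge counts and extremal graphs

module _ {n : ℕ} (G : SimpleGraph n) where

  private
    Listed : Fin n × Fin n → Set
    Listed (i , j) = i Fin.< j × T (adj G i j)

    listed? : ∀ e → Dec (Listed e)
    listed? (i , j) = (i Fin.<? j) ×-dec T? (adj G i j)

    listing : List (Fin n × Fin n) → ℕ
    listing es = length (filter listed? es)

    listing-++ : ∀ es fs → listing (es ++ fs) ≡ listing es + listing fs
    listing-++ es fs =
      ≡.trans (cong length (filter-++ listed? es fs)) (length-++ (filter listed? es))

    listing-drop : ∀ {i j} es → ¬ i Fin.< j → listing ((i , j) ∷ es) ≡ listing es
    listing-drop es i≮j = cong length (filter-reject listed? (i≮j ∘ proj₁))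

    listing-cons : ∀ {i j} es → i Fin.< j → ∀ b → adj G i j ≡ b →
      listing ((i , j) ∷ es) ≡ [ b ]ᵇ + listing es
    listing-cons es i<j true  eq =
      cong length (filter-accept listed? (i<j , subst T (≡.sym eq) tt))
    listing-cons es i<j false eq =
      cong length (filter-reject listed? (subst T eq ∘ proj₂))

    listing-row : ∀ {i js} → All (i Fin.<_) js → listing (map (i ,_) js) ≡ degree (adj G) i js
    listing-row [] = refl
    listing-row {i} {j ∷ js} (i<j ∷ i<js) =
      ≡.trans (listing-cons (map (i ,_) js) i<j (adj G i j) refl)
              (cong ([ adj G i j ]ᵇ +_) (listing-row i<js))

    -- The column of `i` holds only pairs in decreasing order, and `edgeCount` rejects those.
    listing-below : ∀ {i is js} → All (i Fin.<_) is →
      listing (cartesianProduct is (i ∷ js)) ≡ listing (cartesianProduct is js)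
    listing-below [] = refl
    listing-below {i} {k ∷ ks} {js} (i<k ∷ i<ks) = begin
      listing ((k , i) ∷ map (k ,_) js ++ cartesianProduct ks (i ∷ js))
        ≡⟨ listing-drop (map (k ,_) js ++ cartesianProduct ks (i ∷ js)) (<⇒≯ i<k) ⟩
      listing (map (k ,_) js ++ cartesianProduct ks (i ∷ js))
        ≡⟨ listing-++ (map (k ,_) js) _ ⟩
      listing (map (k ,_) js) + listing (cartesianProduct ks (i ∷ js))
        ≡⟨ cong (listing (map (k ,_) js) +_) (listing-below i<ks) ⟩
      listing (map (k ,_) js) + listing (cartesianProduct ks js)
        ≡⟨ listing-++ (map (k ,_) js) _ ⟨
      listing (map (k ,_) js ++ cartesianProduct ks js) ∎
      where open ≡-Reasoning

    listing-square : ∀ {is} → AllPairs Fin._<_ is →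
      listing (cartesianProduct is is) ≡ edges (adj G) is
    listing-square [] = refl
    listing-square {i ∷ is} (i<is ∷ sorted) = begin
      listing ((i , i) ∷ map (i ,_) is ++ cartesianProduct is (i ∷ is))
        ≡⟨ listing-drop {i} (map (i ,_) is ++ cartesianProduct is (i ∷ is)) (<-irrefl refl) ⟩
      listing (map (i ,_) is ++ cartesianProduct is (i ∷ is))
        ≡⟨ listing-++ (map (i ,_) is) _ ⟩
      listing (map (i ,_) is) + listing (cartesianProduct is (i ∷ is))
        ≡⟨ cong₂ _+_ (listing-row i<is) (≡.trans (listing-below i<is) (listing-square sorted)) ⟩
      degree (adj G) i is + edges (adj G) is ∎
      where open ≡-Reasoning

  edgeCount≡edges : edgeCount G ≡ edges (adj G) (allFin n)
  edgeCount≡edges = listing-square (AllPairs.tabulate⁺-< id)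

complete : ∀ n → SimpleGraph n
complete n = record
  { adj    = λ i j → not (does (i ≟ᶠ j))
  ; sym    = λ i j → cong not (does-⇔ (mk⇔ ≡.sym ≡.sym) (i ≟ᶠ j) (j ≟ᶠ i))
  ; irrefl = λ i → cong not (dec-true (i ≟ᶠ i) refl) }

≢⇒adj-complete : ∀ {n} {i j : Fin n} → i ≢ j → T (adj (complete n) i j)
≢⇒adj-complete {i = i} {j} i≢j with i ≟ᶠ j
... | yes eq = i≢j eq
... | no  _  = tt

small-spider-free : ∀ {n} (G : SimpleGraph n) → n ≤ 6 → ¬ ContainsSubgraph G S222
small-spider-free G n≤6 (f , f-inj , _) = <⇒≱ (s≤s n≤6) (injective⇒≤ f-inj)

complete-extremal : ∀ n → n ≤ 6 → IsExc n S222 (triangular n)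
complete-extremal n n≤6 =
  (complete n , connected , small-spider-free (complete n) n≤6 , count-edges) ,
  λ G _ _ → subst₂ _≤_ (≡.sym (edgeCount≡edges G)) (cong triangular size)
    (edges≤triangular (allFin n))
  where
  size : length (allFin n) ≡ n
  size = length-tabulate id
  connected : Connected (complete n)
  connected u v with u ≟ᶠ v
  ... | yes refl = []
  ... | no  u≢v  = ≢⇒adj-complete u≢v ∷ []
  count-edges : edgeCount (complete n) ≡ triangular n
  count-edges = ≡.trans (edgeCount≡edges (complete n))
    (≡.trans (edges-all {r = adj (complete n)} (AllPairs.tabulate⁺ {f = id} ≢⇒adj-complete))
      (cong triangular size))

-- Vertices 0 and 1 are joined to everything, and besides these 2 is joined to 3.
joined : ℕ → ℕ → Bool
joined i j = ((i <ᵇ 2) ∨ (j <ᵇ 2)) ∨ ((i <ᵇ 4) ∧ (j <ᵇ 4))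

joined-sym : ∀ i j → joined i j ≡ joined j i
joined-sym i j = cong₂ _∨_ (∨-comm (i <ᵇ 2) (j <ᵇ 2)) (∧-comm (i <ᵇ 4) (j <ᵇ 4))

twoHubs : ∀ n → SimpleGraph n
twoHubs n = record
  { adj    = λ i j → adj (complete n) i j ∧ joined (toℕ i) (toℕ j)
  ; sym    = λ i j → cong₂ _∧_ (sym (complete n) i j) (joined-sym (toℕ i) (toℕ j))
  ; irrefl = λ i → cong (_∧ joined (toℕ i) (toℕ i)) (irrefl (complete n) i) }

module _ (m : ℕ) where

  private
    n : ℕ
    n = 7 + m

    H : SimpleGraph n
    H = twoHubs n

  hub-adjacent : ∀ {i j : Fin n} → i ≢ j → toℕ i < 2 → T (adj H i j)
  hub-adjacent {i} {j} i≢j i<2 = Equivalence.from T-∧ (≢⇒adj-complete i≢j ,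
    Equivalence.from T-∨ (inj₁ (Equivalence.from T-∨ (inj₁ (<⇒<ᵇ i<2)))))

  twoHubs-connected : Connected H
  twoHubs-connected u v = via (u ≟ᶠ zero) (v ≟ᶠ zero)
    where
    via : Dec (u ≡ zero) → Dec (v ≡ zero) → Walk H u v
    via (yes refl) (yes refl) = []
    via (yes refl) (no v≢0)   = hub-adjacent (v≢0 ∘ ≡.sym) (s≤s z≤n) ∷ []
    via (no u≢0)   (yes refl) = subst T (sym H zero u) (hub-adjacent (u≢0 ∘ ≡.sym) (s≤s z≤n)) ∷ []
    via (no u≢0)   (no v≢0)   = subst T (sym H zero u) (hub-adjacent (u≢0 ∘ ≡.sym) (s≤s z≤n))
      ∷ hub-adjacent (v≢0 ∘ ≡.sym) (s≤s z≤n) ∷ []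

  twoHubs-edges : edgeCount H ≡ 2 * n ∸ 2
  twoHubs-edges = begin
    edgeCount H
      ≡⟨ edgeCount≡edges H ⟩
    edges (adj H) (allFin n)
      ≡⟨ cong₂ _+_ row₀ (cong₂ _+_ row₁ (cong₂ _+_ row₂ (cong₂ _+_ row₃ rest))) ⟩
    (6 + m) + ((5 + m) + (1 + (0 + 0)))
      ≡⟨ m+n∸n≡m (6 + m + (5 + m + 1)) 2 ⟨
    (6 + m) + ((5 + m) + (1 + (0 + 0))) + 2 ∸ 2
      ≡⟨ cong (_∸ 2) (arith m) ⟩
    2 * n ∸ 2 ∎
    where
    open ≡-Reasoning
    arith : ∀ m → (6 + m) + ((5 + m) + (1 + (0 + 0))) + 2 ≡ 2 * (7 + m)
    arith = solve-∀
    not-joined : ∀ {i j : Fin n} → joined (toℕ i) (toℕ j) ≡ false → ¬ T (adj H i j)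
    not-joined ¬joined t = subst T ¬joined (proj₂ (Equivalence.to T-∧ t))
    row₀ : degree (adj H) zero (tabulate {n = 6 + m} (1 Fin.↑ʳ_)) ≡ 6 + m
    row₀ = ≡.trans
      (degree-all {r = adj H} {v = zero} (All.tabulate⁺ {f = 1 Fin.↑ʳ_} λ i →
        hub-adjacent {zero} {1 Fin.↑ʳ i} (λ ()) (s≤s z≤n)))
      (length-tabulate {n = 6 + m} (1 Fin.↑ʳ_))
    row₁ : degree (adj H) (# 1) (tabulate {n = 5 + m} (2 Fin.↑ʳ_)) ≡ 5 + m
    row₁ = ≡.trans
      (degree-all {r = adj H} {v = # 1} (All.tabulate⁺ {f = 2 Fin.↑ʳ_} λ i →
        hub-adjacent {# 1} {2 Fin.↑ʳ i} (λ ()) (s≤s (s≤s z≤n))))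
      (length-tabulate {n = 5 + m} (2 Fin.↑ʳ_))
    row₂ : degree (adj H) (# 2) (tabulate {n = 4 + m} (3 Fin.↑ʳ_)) ≡ 1
    row₂ = cong suc (degree-none {r = adj H} {v = # 2} (All.tabulate⁺ {f = 4 Fin.↑ʳ_} λ i →
      not-joined {# 2} {4 Fin.↑ʳ i} refl))
    row₃ : degree (adj H) (# 3) (tabulate {n = 3 + m} (4 Fin.↑ʳ_)) ≡ 0
    row₃ = degree-none {r = adj H} {v = # 3} (All.tabulate⁺ {f = 4 Fin.↑ʳ_} λ i →
      not-joined {# 3} {4 Fin.↑ʳ i} refl)
    rest : edges (adj H) (tabulate {n = 3 + m} (4 Fin.↑ʳ_)) ≡ 0
    rest = edges-none {r = adj H} (AllPairs.tabulate⁺ {f = 4 Fin.↑ʳ_} λ {i} {j} _ →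
      not-joined {4 Fin.↑ʳ i} {4 Fin.↑ʳ j} refl)

  -- The outer edges of the three legs are disjoint, and each contains a hub or is the edge between
  -- 2 and 3. Two hubs serve at most two legs, so some leg is that edge and the other two use up
  -- both hubs. The centre would then have to be a third hub or a third vertex of the pair.
  twoHubs-spider-free : ¬ ContainsSubgraph H S222
  twoHubs-spider-free (f , f-inj , f-adj) =
    all-legs (leg (# 1) (# 2) 1 refl refl (λ ()) tt tt)
             (leg (# 3) (# 4) 2 refl refl (λ ()) tt tt)
             (leg (# 5) (# 6) 3 refl refl (λ ()) tt tt)
    where
    -- `In 0` describes the hubs and `In 2` the ends of the extra edge. Each class has two members,
    -- so `crowded` refutes three distinct ones.
    In : ℕ → Fin n → Set
    In b x = toℕ x ≡ b ⊎ toℕ x ≡ suc b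

    crowded : ∀ b {x y z} → In b x → In b y → In b z → x ≢ y → x ≢ z → y ≢ z → ⊥
    crowded b (inj₁ x) (inj₁ y) _        x≢y x≢z y≢z = x≢y (toℕ-injective (≡.trans x (≡.sym y)))
    crowded b (inj₂ x) (inj₂ y) _        x≢y x≢z y≢z = x≢y (toℕ-injective (≡.trans x (≡.sym y)))
    crowded b (inj₁ x) (inj₂ y) (inj₁ z) x≢y x≢z y≢z = x≢z (toℕ-injective (≡.trans x (≡.sym z)))
    crowded b (inj₂ x) (inj₁ y) (inj₂ z) x≢y x≢z y≢z = x≢z (toℕ-injective (≡.trans x (≡.sym z)))
    crowded b (inj₁ x) (inj₂ y) (inj₂ z) x≢y x≢z y≢z = y≢z (toℕ-injective (≡.trans y (≡.sym z)))
    crowded b (inj₂ x) (inj₁ y) (inj₁ z) x≢y x≢z y≢z = y≢z (toℕ-injective (≡.trans y (≡.sym z)))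

    hub-or-pair : ∀ {x y} → T (adj H x y) → In 0 x ⊎ In 0 y ⊎ (In 2 x × In 2 y)
    hub-or-pair {x} {y} t = go (toℕ x) (toℕ y) (proj₂ (Equivalence.to T-∧ t))
      where
      go : ∀ i j → T (joined i j) →
        (i ≡ 0 ⊎ i ≡ 1) ⊎ (j ≡ 0 ⊎ j ≡ 1) ⊎ ((i ≡ 2 ⊎ i ≡ 3) × (j ≡ 2 ⊎ j ≡ 3))
      go 0 _ _ = inj₁ (inj₁ refl)
      go 1 _ _ = inj₁ (inj₂ refl)
      go (suc (suc i)) 0 _ = inj₂ (inj₁ (inj₁ refl))
      go (suc (suc i)) 1 _ = inj₂ (inj₁ (inj₂ refl))
      go 2 2 _ = inj₂ (inj₂ (inj₁ refl , inj₁ refl))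
      go 2 3 _ = inj₂ (inj₂ (inj₁ refl , inj₂ refl))
      go 3 2 _ = inj₂ (inj₂ (inj₂ refl , inj₁ refl))
      go 3 3 _ = inj₂ (inj₂ (inj₂ refl , inj₂ refl))

    -- In the numbering of `S222` the legs are 1, 2 and 3, 4 and 5, 6, so halving upwards numbers
    -- them from 1 and gives 0 for the centre. Different numbers certify different vertices.
    legOf : Fin 7 → ℕ
    legOf c = ⌈ toℕ c /2⌉

    apart : ∀ {c d s t} → legOf c ≡ s → legOf d ≡ t → s ≢ t → f c ≢ f d
    apart c d s≢t eq = s≢t (≡.trans (≡.sym c) (≡.trans (cong legOf (f-inj eq)) d))

    HubLeg PairLeg : ℕ → Set
    HubLeg t = ∃ λ c → legOf c ≡ t × In 0 (f c)
    PairLeg t = ∃₂ λ a b → legOf a ≡ t × f a ≢ f b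
      × T (adj H (f zero) (f a)) × In 2 (f a) × In 2 (f b) × legOf b ≡ t

    leg : ∀ a b t → legOf a ≡ t → legOf b ≡ t → a ≢ b →
      T (adj S222 zero a) → T (adj S222 a b) → HubLeg t ⊎ PairLeg t
    leg a b t a∈ b∈ a≢b 0a ab with hub-or-pair (f-adj a b ab)
    ... | inj₁ h                = inj₁ (a , a∈ , h)
    ... | inj₂ (inj₁ h)         = inj₁ (b , b∈ , h)
    ... | inj₂ (inj₂ (pa , pb)) = inj₂ (a , b , a∈ , a≢b ∘ f-inj , f-adj zero a 0a , pa , pb , b∈)

    pair-leg : ∀ {t u v} → 0 ≢ t → 0 ≢ u → 0 ≢ v → t ≢ u → t ≢ v → u ≢ v →
      PairLeg t → HubLeg u ⊎ PairLeg u → HubLeg v ⊎ PairLeg v → ⊥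
    pair-leg _ _ _ t≢u _ _ (a , b , a∈ , fa≢fb , _ , pa , pb , b∈)
      (inj₂ (c , _ , c∈ , _ , _ , pc , _)) _ =
      crowded 2 pa pb pc fa≢fb (apart a∈ c∈ t≢u) (apart b∈ c∈ t≢u)
    pair-leg _ _ _ _ t≢v _ (a , b , a∈ , fa≢fb , _ , pa , pb , b∈) _
      (inj₂ (c , _ , c∈ , _ , _ , pc , _)) =
      crowded 2 pa pb pc fa≢fb (apart a∈ c∈ t≢v) (apart b∈ c∈ t≢v)
    pair-leg 0≢t 0≢u 0≢v _ _ u≢v (a , b , a∈ , fa≢fb , 0a , pa , pb , b∈)
      (inj₁ (c , c∈ , hc)) (inj₁ (d , d∈ , hd)) with hub-or-pair 0a
    ... | inj₁ h₀ = crowded 0 h₀ hc hd (apart refl c∈ 0≢u) (apart refl d∈ 0≢v) (apart c∈ d∈ u≢v)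
    ... | inj₂ (inj₂ (p₀ , _)) = crowded 2 p₀ pa pb (apart refl a∈ 0≢t) (apart refl b∈ 0≢t) fa≢fb
    ... | inj₂ (inj₁ ha) = hub≢pair ha pa
      where
      hub≢pair : ∀ {x} → In 0 x → ¬ In 2 x
      hub≢pair (inj₁ h) (inj₁ q) with () ← ≡.trans (≡.sym h) q
      hub≢pair (inj₁ h) (inj₂ q) with () ← ≡.trans (≡.sym h) q
      hub≢pair (inj₂ h) (inj₁ q) with () ← ≡.trans (≡.sym h) q
      hub≢pair (inj₂ h) (inj₂ q) with () ← ≡.trans (≡.sym h) q

    all-legs : HubLeg 1 ⊎ PairLeg 1 → HubLeg 2 ⊎ PairLeg 2 → HubLeg 3 ⊎ PairLeg 3 → ⊥
    all-legs (inj₂ q) s t = pair-leg (λ ()) (λ ()) (λ ()) (λ ()) (λ ()) (λ ()) q s t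
    all-legs s (inj₂ q) t = pair-leg (λ ()) (λ ()) (λ ()) (λ ()) (λ ()) (λ ()) q s t
    all-legs s t (inj₂ q) = pair-leg (λ ()) (λ ()) (λ ()) (λ ()) (λ ()) (λ ()) q s t
    all-legs (inj₁ (c , c∈ , hc)) (inj₁ (d , d∈ , hd)) (inj₁ (g , g∈ , hg)) =
      crowded 0 hc hd hg (apart c∈ d∈ λ ()) (apart c∈ g∈ λ ()) (apart d∈ g∈ λ ())

twoHubs-extremal : ∀ n → 7 ≤ n → IsExc n S222 (2 * n ∸ 2)
twoHubs-extremal n 7≤n with m , refl ← m≤n⇒∃[o]m+o≡n 7≤n =
  (twoHubs n , twoHubs-connected m , twoHubs-spider-free m , twoHubs-edges m) ,
  λ G connected free → subst (_≤ 2 * n ∸ 2) (≡.sym (edgeCount≡edges G))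
    (SpiderFree.sparse-graph G free connected 7≤n)

theorem1p8 : (∀ (n : ℕ) → 7 ≤ n → IsExc n S222 (2 * n ∸ 2))
    × (∀ (n : ℕ) → 1 ≤ n → n ≤ 6 → IsExc n S222 (n C 2))
theorem1p8 = twoHubs-extremal , λ n 1≤n n≤6 →
  subst (IsExc n S222) (triangular≡C2 n n≤6) (complete-extremal n n≤6)
  where
  triangular≡C2 : ∀ n → n ≤ 6 → triangular n ≡ n C 2
  triangular≡C2 0 _ = refl
  triangular≡C2 1 _ = refl
  triangular≡C2 2 _ = refl
  triangular≡C2 3 _ = refl
  triangular≡C2 4 _ = refl
  triangular≡C2 5 _ = refl
  triangular≡C2 6 _ = refl
  triangular≡C2 (suc (suc (suc (suc (suc (suc (suc _)))))))
    (s≤s (s≤s (s≤s (s≤s (s≤s (s≤s ()))))))
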